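{- Let $d\ge 1$ and let $v_1,\dots,v_m\in\mathbb{C}^d$ be vectors such that $m$ is even, $\sum_{i=1}^m |\langle u,v_i\rangle|^2=1$ for every unit vector $u\in\mathbb{C}^d$, $\|v_i\|^2=\alpha$ for every $i\in[m]$ (for some $\alpha>0$), and $m\ge 221\,d^2$. Then there is a deterministic algorithm that, given $v_1,\dots,v_m$ as input, finds a partition $S_1,S_2$ of $[m]$ such that $|S_1|=|S_2|$ and \[ \sum_{i\in S_j}|\langle u,v_i\rangle|^2\le \frac34 \] for every unit vector $u\in\mathbb{C}^d$ and every $j\in\{1,2\}$. The algorithm runs in time polynomial in $m$ and $d$. -}

module Defs where

open import Algebra.Bundles using (RawMonoid)
import Algebra.Definitions.RawMonoid as RawMonoidOps
open import Data.Bool using (if_then_else_)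
open import Data.Fin using (Fin; zero; suc; toℕ)
open import Data.Fin.Subset using (Subset)
open import Data.Nat as ℕ using (ℕ; zero; suc; _⊔_)
import Data.Nat.Properties as ℕ
open import Data.Product using (∃-syntax; _×_; _,_)
open import Data.Rational as ℚ using (ℚ; 0ℚ; 1ℚ; ½; ∣_∣; 1/_)
import Data.Rational.Properties as ℚ
open import Data.Rational.Solver using (module +-*-Solver)
open import Data.Vec using (lookup)
open import Data.Vec.Functional using (Vector; []; _∷_; map; concat; tail)
open import Level using (0ℓ)
open import Relation.Binary.PropositionalEquality
  using (_≡_; refl; sym; trans; cong; cong₂; subst)
open import Relation.Nullary using (¬_; contradiction)

------------------------------------------------------------------------
-- Real numbers: Cauchy sequences of rationals, up to _≈ʳ_

IsCauchy : (ℕ → ℚ) → Set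
IsCauchy x = ∀ ε → 0ℚ ℚ.< ε →
  ∃[ N ] (∀ m n → N ℕ.≤ m → N ℕ.≤ n → ∣ x m ℚ.- x n ∣ ℚ.< ε)

record ℝ : Set where
  constructor mkℝ
  field
    seq    : ℕ → ℚ
    cauchy : IsCauchy seq

open ℝ public

infix 4 _≈ʳ_ _≤ʳ_ _<ʳ_

_≈ʳ_ : ℝ → ℝ → Set
x ≈ʳ y = ∀ ε → 0ℚ ℚ.< ε →
  ∃[ N ] (∀ n → N ℕ.≤ n → ∣ seq x n ℚ.- seq y n ∣ ℚ.< ε)

_≤ʳ_ : ℝ → ℝ → Set
x ≤ʳ y = ∀ ε → 0ℚ ℚ.< ε →
  ∃[ N ] (∀ n → N ℕ.≤ n → seq x n ℚ.< seq y n ℚ.+ ε)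

_<ʳ_ : ℝ → ℝ → Set
x <ʳ y = ∃[ ε ] (0ℚ ℚ.< ε ×
  ∃[ N ] (∀ n → N ℕ.≤ n → seq x n ℚ.+ ε ℚ.≤ seq y n))

private abstract
  halfPos : ∀ {ε} → 0ℚ ℚ.< ε → 0ℚ ℚ.< ½ ℚ.* ε
  halfPos {ε} 0<ε = subst (ℚ._< ½ ℚ.* ε) (ℚ.*-zeroʳ ½) (ℚ.*-monoʳ-<-pos ½ 0<ε)

  half+half : ∀ ε → ½ ℚ.* ε ℚ.+ ½ ℚ.* ε ≡ ε
  half+half ε = trans (sym (ℚ.*-distribʳ-+ ε ½ ½)) (ℚ.*-identityˡ ε)

  +-split : ∀ a b c d → (a ℚ.+ b) ℚ.- (c ℚ.+ d) ≡ (a ℚ.- c) ℚ.+ (b ℚ.- d)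
  +-split = solve 4 (λ a b c d → (a :+ b) :- (c :+ d) := (a :- c) :+ (b :- d)) refl
    where open +-*-Solver

  neg-split : ∀ a b → ℚ.- a ℚ.- (ℚ.- b) ≡ ℚ.- (a ℚ.- b)
  neg-split = solve 2 (λ a b → :- a :- (:- b) := :- (a :- b)) refl
    where open +-*-Solver

  *-split : ∀ a b c d →
    a ℚ.* b ℚ.- c ℚ.* d ≡ a ℚ.* (b ℚ.- d) ℚ.+ d ℚ.* (a ℚ.- c)
  *-split = solve 4 (λ a b c d → a :* b :- c :* d := a :* (b :- d) :+ d :* (a :- c)) refl
    where open +-*-Solver

  recover : ∀ a b → b ℚ.+ (a ℚ.- b) ≡ a
  recover = solve 2 (λ a b → b :+ (a :- b) := a) refl
    where open +-*-Solver

  +-cauchy : ∀ {x y} → IsCauchy x → IsCauchy y → IsCauchy (λ n → x n ℚ.+ y n)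
  +-cauchy {x} {y} cx cy ε 0<ε
    with M , hx ← cx (½ ℚ.* ε) (halfPos 0<ε) | N , hy ← cy (½ ℚ.* ε) (halfPos 0<ε)
    = M ⊔ N , λ m n M⊔N≤m M⊔N≤n → begin-strict
      ∣ (x m ℚ.+ y m) ℚ.- (x n ℚ.+ y n) ∣
        ≡⟨ cong ∣_∣ (+-split (x m) (y m) (x n) (y n)) ⟩
      ∣ (x m ℚ.- x n) ℚ.+ (y m ℚ.- y n) ∣
        ≤⟨ ℚ.∣p+q∣≤∣p∣+∣q∣ (x m ℚ.- x n) (y m ℚ.- y n) ⟩
      ∣ x m ℚ.- x n ∣ ℚ.+ ∣ y m ℚ.- y n ∣
        <⟨ ℚ.+-mono-<
             (hx m n (ℕ.m⊔n≤o⇒m≤o M N M⊔N≤m) (ℕ.m⊔n≤o⇒m≤o M N M⊔N≤n))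
             (hy m n (ℕ.m⊔n≤o⇒n≤o M N M⊔N≤m) (ℕ.m⊔n≤o⇒n≤o M N M⊔N≤n)) ⟩
      ½ ℚ.* ε ℚ.+ ½ ℚ.* ε
        ≡⟨ half+half ε ⟩
      ε ∎
    where open ℚ.≤-Reasoning

  neg-cauchy : ∀ {x} → IsCauchy x → IsCauchy (λ n → ℚ.- x n)
  neg-cauchy {x} cx ε 0<ε with N , h ← cx ε 0<ε
    = N , λ m n N≤m N≤n →
      subst (ℚ._< ε)
        (sym (trans (cong ∣_∣ (neg-split (x m) (x n))) (ℚ.∣-p∣≡∣p∣ (x m ℚ.- x n))))
        (h m n N≤m N≤n)

  eventuallyBounded : ∀ {x} → IsCauchy x →
    ∃[ B ] (0ℚ ℚ.< B × ∃[ N ] (∀ n → N ℕ.≤ n → ∣ x n ∣ ℚ.≤ B))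
  eventuallyBounded {x} cx with N , h ← cx 1ℚ (ℚ.positive⁻¹ 1ℚ)
    = ∣ x N ∣ ℚ.+ 1ℚ
    , ℚ.+-mono-≤-< (ℚ.0≤∣p∣ (x N)) (ℚ.positive⁻¹ 1ℚ)
    , N
    , λ n N≤n → begin
        ∣ x n ∣                        ≡⟨ cong ∣_∣ (sym (recover (x n) (x N))) ⟩
        ∣ x N ℚ.+ (x n ℚ.- x N) ∣      ≤⟨ ℚ.∣p+q∣≤∣p∣+∣q∣ (x N) (x n ℚ.- x N) ⟩
        ∣ x N ∣ ℚ.+ ∣ x n ℚ.- x N ∣    ≤⟨ ℚ.+-monoʳ-≤ ∣ x N ∣ (ℚ.<⇒≤ (h n N N≤n ℕ.≤-refl)) ⟩
        ∣ x N ∣ ℚ.+ 1ℚ                 ∎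
    where open ℚ.≤-Reasoning

  divideBound : ∀ {B ε} → 0ℚ ℚ.< B → 0ℚ ℚ.< ε → ∃[ δ ] (0ℚ ℚ.< δ × B ℚ.* δ ≡ ε)
  divideBound {B} {ε} 0<B 0<ε = δ , 0<δ , Bδ≡ε
    where
    B⁻¹ : ℚ
    B⁻¹ = (1/ B) {{ℚ.pos⇒nonZero B {{ℚ.positive 0<B}}}}
    δ : ℚ
    δ = B⁻¹ ℚ.* ε
    0<δ : 0ℚ ℚ.< δ
    0<δ = ℚ.positive⁻¹ δ
      {{ℚ.pos*pos⇒pos B⁻¹ {{ℚ.1/pos⇒pos B {{ℚ.positive 0<B}}}} ε {{ℚ.positive 0<ε}}}}
    Bδ≡ε : B ℚ.* δ ≡ ε
    Bδ≡ε = trans (sym (ℚ.*-assoc B B⁻¹ ε))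
          (trans (cong (ℚ._* ε) (ℚ.*-inverseʳ B {{ℚ.pos⇒nonZero B {{ℚ.positive 0<B}}}}))
                 (ℚ.*-identityˡ ε))

  ∣*∣-< : ∀ {B δ} a b → 0ℚ ℚ.< B → ∣ a ∣ ℚ.≤ B → ∣ b ∣ ℚ.< δ → ∣ a ℚ.* b ∣ ℚ.< B ℚ.* δ
  ∣*∣-< {B} {δ} a b 0<B a≤B b<δ = begin-strict
    ∣ a ℚ.* b ∣      ≡⟨ ℚ.∣p*q∣≡∣p∣*∣q∣ a b ⟩
    ∣ a ∣ ℚ.* ∣ b ∣  ≤⟨ ℚ.*-monoʳ-≤-nonNeg ∣ b ∣ {{ℚ.nonNegative (ℚ.0≤∣p∣ b)}} a≤B ⟩
    B ℚ.* ∣ b ∣      <⟨ ℚ.*-monoʳ-<-pos B {{ℚ.positive 0<B}} b<δ ⟩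
    B ℚ.* δ          ∎
    where open ℚ.≤-Reasoning

  *-close : ∀ {A B α β ε} a b c d → 0ℚ ℚ.< A → 0ℚ ℚ.< B →
    A ℚ.* α ≡ ½ ℚ.* ε → B ℚ.* β ≡ ½ ℚ.* ε →
    ∣ a ∣ ℚ.≤ A → ∣ d ∣ ℚ.≤ B → ∣ a ℚ.- c ∣ ℚ.< β → ∣ b ℚ.- d ∣ ℚ.< α →
    ∣ a ℚ.* b ℚ.- c ℚ.* d ∣ ℚ.< ε
  *-close {A} {B} {α} {β} {ε} a b c d 0<A 0<B Aα≡½ε Bβ≡½ε a≤A d≤B a-c<β b-d<α = begin-strict
    ∣ a ℚ.* b ℚ.- c ℚ.* d ∣
      ≡⟨ cong ∣_∣ (*-split a b c d) ⟩
    ∣ a ℚ.* (b ℚ.- d) ℚ.+ d ℚ.* (a ℚ.- c) ∣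
      ≤⟨ ℚ.∣p+q∣≤∣p∣+∣q∣ (a ℚ.* (b ℚ.- d)) (d ℚ.* (a ℚ.- c)) ⟩
    ∣ a ℚ.* (b ℚ.- d) ∣ ℚ.+ ∣ d ℚ.* (a ℚ.- c) ∣
      <⟨ ℚ.+-mono-< (∣*∣-< a (b ℚ.- d) 0<A a≤A b-d<α)
                    (∣*∣-< d (a ℚ.- c) 0<B d≤B a-c<β) ⟩
    A ℚ.* α ℚ.+ B ℚ.* β
      ≡⟨ cong₂ ℚ._+_ Aα≡½ε Bβ≡½ε ⟩
    ½ ℚ.* ε ℚ.+ ½ ℚ.* ε
      ≡⟨ half+half ε ⟩
    ε ∎
    where open ℚ.≤-Reasoning

  *-cauchy : ∀ {x y} → IsCauchy x → IsCauchy y → IsCauchy (λ n → x n ℚ.* y n)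
  *-cauchy {x} {y} cx cy ε 0<ε =
    let A , 0<A , K , x≤A = eventuallyBounded cx
        B , 0<B , L , y≤B = eventuallyBounded cy
        α , 0<α , Aα≡½ε   = divideBound 0<A (halfPos 0<ε)
        β , 0<β , Bβ≡½ε   = divideBound 0<B (halfPos 0<ε)
        M , hx            = cx β 0<β
        N , hy            = cy α 0<α
    in (K ⊔ L) ⊔ (M ⊔ N) , λ m n ≤m ≤n →
      let K⊔L≤m = ℕ.m⊔n≤o⇒m≤o (K ⊔ L) (M ⊔ N) ≤m
          K⊔L≤n = ℕ.m⊔n≤o⇒m≤o (K ⊔ L) (M ⊔ N) ≤n
          M⊔N≤m = ℕ.m⊔n≤o⇒n≤o (K ⊔ L) (M ⊔ N) ≤m
          M⊔N≤n = ℕ.m⊔n≤o⇒n≤o (K ⊔ L) (M ⊔ N) ≤n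
      in *-close (x m) (y m) (x n) (y n) 0<A 0<B Aα≡½ε Bβ≡½ε
           (x≤A m (ℕ.m⊔n≤o⇒m≤o K L K⊔L≤m))
           (y≤B n (ℕ.m⊔n≤o⇒n≤o K L K⊔L≤n))
           (hx m n (ℕ.m⊔n≤o⇒m≤o M N M⊔N≤m) (ℕ.m⊔n≤o⇒m≤o M N M⊔N≤n))
           (hy m n (ℕ.m⊔n≤o⇒n≤o M N M⊔N≤m) (ℕ.m⊔n≤o⇒n≤o M N M⊔N≤n))

fromℚ : ℚ → ℝ
fromℚ q = mkℝ (λ _ → q) λ ε 0<ε →
  0 , λ _ _ _ _ → subst (ℚ._< ε) (sym (cong ∣_∣ (ℚ.+-inverseʳ q))) 0<ε

0ʳ 1ʳ : ℝ
0ʳ = fromℚ 0ℚ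
1ʳ = fromℚ 1ℚ

infixl 6 _+ʳ_ _-ʳ_
infixl 7 _*ʳ_
infix  8 -ʳ_

_+ʳ_ _*ʳ_ : ℝ → ℝ → ℝ
x +ʳ y = mkℝ (λ n → seq x n ℚ.+ seq y n) (+-cauchy {seq x} {seq y} (cauchy x) (cauchy y))
x *ʳ y = mkℝ (λ n → seq x n ℚ.* seq y n) (*-cauchy {seq x} {seq y} (cauchy x) (cauchy y))

-ʳ_ : ℝ → ℝ
-ʳ x = mkℝ (λ n → ℚ.- seq x n) (neg-cauchy {seq x} (cauchy x))

_-ʳ_ : ℝ → ℝ → ℝ
x -ʳ y = x +ʳ (-ʳ y)

+ʳ-rawMonoid : RawMonoid 0ℓ 0ℓ
+ʳ-rawMonoid = record { Carrier = ℝ ; _≈_ = _≈ʳ_ ; _∙_ = _+ʳ_ ; ε = 0ʳ }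

open RawMonoidOps +ʳ-rawMonoid public using () renaming (sum to sumʳ)

------------------------------------------------------------------------
-- Complex numbers and the Hermitian space ℂ^d

record ℂ : Set where
  constructor _+i_
  field
    re im : ℝ

open ℂ public

0ᶜ : ℂ
0ᶜ = 0ʳ +i 0ʳ

infixl 6 _+ᶜ_
infixl 7 _*ᶜ_

_+ᶜ_ _*ᶜ_ : ℂ → ℂ → ℂ
(a +i b) +ᶜ (c +i d) = (a +ʳ c) +i (b +ʳ d)
(a +i b) *ᶜ (c +i d) = (a *ʳ c -ʳ b *ʳ d) +i (a *ʳ d +ʳ b *ʳ c)

conj : ℂ → ℂ
conj (a +i b) = a +i (-ʳ b)

∣_∣² : ℂ → ℝ
∣ a +i b ∣² = a *ʳ a +ʳ b *ʳ b

+ᶜ-rawMonoid : RawMonoid 0ℓ 0ℓ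
+ᶜ-rawMonoid = record
  { Carrier = ℂ
  ; _≈_     = λ z w → re z ≈ʳ re w × im z ≈ʳ im w
  ; _∙_     = _+ᶜ_
  ; ε       = 0ᶜ
  }

open RawMonoidOps +ᶜ-rawMonoid public using () renaming (sum to sumᶜ)

⟨_,_⟩ : ∀ {d} → Vector ℂ d → Vector ℂ d → ℂ
⟨ u , v ⟩ = sumᶜ λ k → conj (u k) *ᶜ v k

‖_‖² : ∀ {d} → Vector ℂ d → ℝ
‖ u ‖² = sumʳ λ k → ∣ u k ∣²

-- ‖u‖ = 1, written without the square root.
IsUnit : ∀ {d} → Vector ℂ d → Set
IsUnit u = ‖ u ‖² ≈ʳ 1ʳ

sumOver : ∀ {m} → Subset m → Vector ℝ m → ℝ
sumOver S f = sumʳ λ i → if lookup S i then f i else 0ʳ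

------------------------------------------------------------------------
-- Algorithms: structured programs for a real random-access machine.
--
-- The machine has index registers (natural numbers), an addressable memory
-- of natural numbers and an addressable memory of exact real numbers.
-- Addresses are always taken from index registers. Every instruction and
-- every evaluation of a test costs one unit of time. Naturals support only
-- addition and truncated subtraction, so in t steps their length grows by at
-- most t bits. The only real constants are 0 and 1, and there is no division, no
-- rounding and no square root.

Reg : Set
Reg = ℕ

record State : Set where
  constructor mkState
  field
    reg  : Reg → ℕ
    nmem : ℕ → ℕ
    rmem : ℕ → ℝ

open State public

infix 9 _[_≔_]

_[_≔_] : {A : Set} → (ℕ → A) → ℕ → A → (ℕ → A)
(f [ a ≔ x ]) b = if a ℕ.≡ᵇ b then x else f b

data Instr : Set where
  const         : Reg → ℕ → Instr
  add sub       : Reg → Reg → Reg → Instr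
  load store    : Reg → Reg → Instr
  zeroR oneR    : Reg → Instr
  addR subR mulR : Reg → Reg → Reg → Instr

exec : Instr → State → State
exec (const x n)   (mkState ρ ν μ) = mkState (ρ [ x ≔ n ]) ν μ
exec (add x y z)   (mkState ρ ν μ) = mkState (ρ [ x ≔ ρ y ℕ.+ ρ z ]) ν μ
exec (sub x y z)   (mkState ρ ν μ) = mkState (ρ [ x ≔ ρ y ℕ.∸ ρ z ]) ν μ
exec (load x y)    (mkState ρ ν μ) = mkState (ρ [ x ≔ ν (ρ y) ]) ν μ
exec (store x y)   (mkState ρ ν μ) = mkState ρ (ν [ ρ x ≔ ρ y ]) μ
exec (zeroR x)     (mkState ρ ν μ) = mkState ρ ν (μ [ ρ x ≔ 0ʳ ])
exec (oneR x)      (mkState ρ ν μ) = mkState ρ ν (μ [ ρ x ≔ 1ʳ ])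
exec (addR x y z)  (mkState ρ ν μ) = mkState ρ ν (μ [ ρ x ≔ μ (ρ y) +ʳ μ (ρ z) ])
exec (subR x y z)  (mkState ρ ν μ) = mkState ρ ν (μ [ ρ x ≔ μ (ρ y) -ʳ μ (ρ z) ])
exec (mulR x y z)  (mkState ρ ν μ) = mkState ρ ν (μ [ ρ x ≔ μ (ρ y) *ʳ μ (ρ z) ])

data Test : Set where
  leq leqR : Reg → Reg → Test

Holds : Test → State → Set
Holds (leq x y)  s = reg s x ℕ.≤ reg s y
Holds (leqR x y) s = rmem s (reg s x) ≤ʳ rmem s (reg s y)

infixr 5 _⨾_

data Program : Set where
  instr : Instr → Program
  _⨾_   : Program → Program → Program
  ite   : Test → Program → Program → Program
  while : Test → Program → Program

-- Run P s s′ t : started in s, the program P halts in s′ after t time units.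
data Run : Program → State → State → ℕ → Set where
  r-instr : ∀ {a s} → Run (instr a) s (exec a s) 1
  r-seq   : ∀ {P Q s s′ s″ t t′} →
            Run P s s′ t → Run Q s′ s″ t′ → Run (P ⨾ Q) s s″ (t ℕ.+ t′)
  r-then  : ∀ {b P Q s s′ t} →
            Holds b s → Run P s s′ t → Run (ite b P Q) s s′ (suc t)
  r-else  : ∀ {b P Q s s′ t} →
            ¬ Holds b s → Run Q s s′ t → Run (ite b P Q) s s′ (suc t)
  r-loop  : ∀ {b P s s′ s″ t t′} →
            Holds b s → Run P s s′ t → Run (while b P) s′ s″ t′ →
            Run (while b P) s s″ (suc (t ℕ.+ t′))
  r-exit  : ∀ {b P s} → ¬ Holds b s → Run (while b P) s s 1

-- The machine is deterministic: a halting run has a unique result and cost.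
Run-deterministic : ∀ {P s s₁ s₂ t₁ t₂} →
  Run P s s₁ t₁ → Run P s s₂ t₂ → s₁ ≡ s₂ × t₁ ≡ t₂
Run-deterministic r-instr r-instr = refl , refl
Run-deterministic (r-seq p q) (r-seq p′ q′)
  with refl , refl ← Run-deterministic p p′
  with refl , refl ← Run-deterministic q q′ = refl , refl
Run-deterministic (r-then _ p) (r-then _ p′)
  with refl , refl ← Run-deterministic p p′ = refl , refl
Run-deterministic (r-then h _) (r-else ¬h _) = contradiction h ¬h
Run-deterministic (r-else ¬h _) (r-then h _) = contradiction h ¬h
Run-deterministic (r-else _ p) (r-else _ p′)
  with refl , refl ← Run-deterministic p p′ = refl , refl
Run-deterministic (r-loop _ p q) (r-loop _ p′ q′)
  with refl , refl ← Run-deterministic p p′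
  with refl , refl ← Run-deterministic q q′ = refl , refl
Run-deterministic (r-loop h _ _) (r-exit ¬h) = contradiction h ¬h
Run-deterministic (r-exit ¬h) (r-loop h _ _) = contradiction h ¬h
Run-deterministic (r-exit _) (r-exit _) = refl , refl

padWithZeros : ∀ {n} → Vector ℝ n → ℕ → ℝ
padWithZeros {zero}  f a       = 0ʳ
padWithZeros {suc n} f zero    = f zero
padWithZeros {suc n} f (suc a) = padWithZeros (tail f) a

-- Register 0 holds d and register 1 holds m. The real memory holds the
-- coordinates of v₁, …, v_m one vector after the other, each coordinate as
-- its real part followed by its imaginary part. All else is 0.
inputState : ∀ {d m} → (Fin m → Vector ℂ d) → State
inputState {d} {m} v = mkState
  ((λ _ → 0) [ 0 ≔ d ] [ 1 ≔ m ])
  (λ _ → 0)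
  (padWithZeros (concat (map (λ vᵢ → concat (map (λ z → re z ∷ im z ∷ []) vᵢ)) v)))

-- The output is the indicator vector of S₁, in cells 0, …, m − 1 of the
-- memory of naturals: this names the partition {S₁, [m] ∖ S₁}.
Outputs : ∀ {m} → State → Subset m → Set
Outputs s S₁ = ∀ i → nmem s (toℕ i) ≡ (if lookup S₁ i then 1 else 0)

{-# OPTIONS --safe #-}
-- Pair the vectors up and give the two vectors of each pair opposite signs ε, so the signs
-- balance. For X = Σ εᵢ vᵢvᵢ* the Hilbert–Schmidt inner product satisfies
-- ⟪vv*, ww*⟫ = |⟨v,w⟩|², so adding a pair (a, b) with sign s changes ‖X‖² by
-- 2s⟪X, aa* − bb*⟫ + ‖a‖⁴ + ‖b‖⁴ − 2|⟨a,b⟩|². Choosing s greedily to make the first term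
-- nonpositive gives ‖X‖² ≤ mα² in the end. Taking traces, mα = d, so mα² = d²/m ≤ 1/4.
-- Hence |⟨u, Xu⟩| ≤ 1/2 for unit u, and both halves of Σ |⟨u,vᵢ⟩|² = 1 are at most 3/4.
-- The sign of ⟪X, aa* − bb*⟫ is computed from the Gram matrix in three nested loops.
module Submission where

open import Defs
open import Axiom.ExcludedMiddle using (ExcludedMiddle)
open import Data.Fin using (Fin)
open import Data.Fin.Subset using (Subset; _∪_; _∩_; ∣_∣) renaming (⊤ to full; ⊥ to empty)
open import Data.Integer using (+_)
open import Data.Nat using (ℕ; _+_; _*_; _^_; _≤_)
open import Data.Nat.Divisibility using (_∣_)
open import Data.Product using (_×_; Σ-syntax)
open import Data.Rational using (_/_)
open import Data.Vec.Functional using (Vector)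
open import Level using (0ℓ)
open import Relation.Binary.PropositionalEquality using (_≡_)

open import Algebra.Bundles using (CommutativeRing)
import Algebra.Solver.Ring as RingSolver
import Algebra.Solver.Ring.AlmostCommutativeRing as ACR
open import Data.Bool using (Bool; true; false; not; if_then_else_)
open import Data.Fin using (zero; suc; toℕ; fromℕ; fromℕ<; inject₁; combine; _≟_)
import Data.Fin.Properties as Fin
open import Data.Fin.Subset using (∁)
open import Data.Fin.Subset.Properties using (p∪∁p≡⊤; ∩-inverseʳ)
open import Data.List using (List; []; _∷_; length)
open import Data.Maybe using (Maybe; nothing; just)
open import Data.Nat using (zero; suc; _⊔_; z≤n; s≤s; s≤s⁻¹; _<_; _≡ᵇ_; NonZero; >-nonZero)
open import Data.Nat.Divisibility using (divides)
import Data.Nat.Properties as ℕ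
open import Data.Nat.Solver using () renaming (module +-*-Solver to ℕ-Solver)
open import Data.Product using (∃-syntax; _,_; proj₁; proj₂; swap)
open import Data.Rational as ℚ using (ℚ; 0ℚ; 1ℚ; ½)
import Data.Rational.Properties as ℚ
open import Data.Rational.Solver using (module +-*-Solver)
open import Data.Sum using (_⊎_; inj₁; inj₂)
open import Data.Vec using (lookup; tabulate)
open import Data.Vec.Functional as Vector using (concat; map; tail)
open import Data.Vec.Properties using (lookup∘tabulate; lookup-map)
open import Relation.Binary.Bundles using (Preorder)
open import Relation.Binary.PropositionalEquality
  using (_≢_; refl; sym; trans; cong; cong₂; subst; subst₂; module ≡-Reasoning)
import Relation.Binary.Reasoning.Preorder as PreorderReasoning
import Relation.Binary.Reasoning.Setoid as SetoidReasoning
open import Relation.Nullary using (¬_; Dec; yes; no; contradiction)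

-- Order and ring structure of ℝ

-- The quadratic form ⟨u, Xu⟩ is ⟪X, uu*⟫ and uu* has Hilbert-Schmidt norm 1, so Cauchy-Schwarz in
-- the space of matrices bounds it by ‖X‖; this is how a Euclidean potential controls an operator
-- norm. Opposite signs within a pair leave one free sign, and one of its two values always makes
-- the linear term nonpositive. X itself is never stored. Its inner product with a further aa* is a
-- signed sum of the numbers |⟨vⱼ, a⟩|², and the signs needed are the output cells already written.
-- Two obstacles shape the rest. The order on Cauchy reals is not decidable constructively, so
-- `ExcludedMiddle` selects the branch taken at a `leqR` test and makes `_≼_` total; `greedy` is a
-- closed term that does not mention it. Square roots and division are not defined on `ℝ`, so
-- Cauchy-Schwarz appears as the expansion of a square, and bounds with a denominator are first
-- multiplied by a natural number that `·-cancel-nonneg` removes again.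

0<½* : ∀ {ε} → 0ℚ ℚ.< ε → 0ℚ ℚ.< ½ ℚ.* ε
0<½* {ε} 0<ε = subst (ℚ._< ½ ℚ.* ε) (ℚ.*-zeroʳ ½) (ℚ.*-monoʳ-<-pos ½ 0<ε)

½*+½* : ∀ ε → ½ ℚ.* ε ℚ.+ ½ ℚ.* ε ≡ ε
½*+½* ε = trans (sym (ℚ.*-distribʳ-+ ε ½ ½)) (ℚ.*-identityˡ ε)

p≤∣p∣ : ∀ p → p ℚ.≤ ℚ.∣ p ∣
p≤∣p∣ p with ℚ.≤-total 0ℚ p
... | inj₁ 0≤p = ℚ.≤-reflexive (sym (ℚ.0≤p⇒∣p∣≡p 0≤p))
... | inj₂ p≤0 = ℚ.≤-trans p≤0 (ℚ.0≤∣p∣ p)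

0≤p*p : ∀ p → 0ℚ ℚ.≤ p ℚ.* p
0≤p*p p with ℚ.≤-total 0ℚ p
... | inj₁ 0≤p = subst (ℚ._≤ p ℚ.* p) (ℚ.*-zeroˡ p)
  (ℚ.*-monoʳ-≤-nonNeg p {{ℚ.nonNegative 0≤p}} 0≤p)
... | inj₂ p≤0 = subst (ℚ._≤ p ℚ.* p) (ℚ.*-zeroˡ p)
  (ℚ.*-monoʳ-≤-nonPos p {{ℚ.nonPositive p≤0}} p≤0)

-- Wrapping the relations in records lets Agda infer their endpoints.

infix 4 _≼_ _≋_

record _≼_ (x y : ℝ) : Set where
  constructor wrap
  field unwrap : x ≤ʳ y

record _≋_ (x y : ℝ) : Set where
  constructor wrap
  field unwrap : x ≈ʳ y

open _≼_ public renaming (unwrap to ≼⇒≤ʳ)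
open _≋_ public renaming (unwrap to ≋⇒≈ʳ)

≼-pointwise : ∀ {x y} → (∀ n → seq x n ℚ.≤ seq y n) → x ≼ y
≼-pointwise {x} {y} h = wrap λ ε 0<ε → 0 , λ n _ →
  subst (ℚ._< seq y n ℚ.+ ε) (ℚ.+-identityʳ (seq x n)) (ℚ.+-mono-≤-< (h n) 0<ε)

≼-refl : ∀ {x} → x ≼ x
≼-refl = ≼-pointwise λ _ → ℚ.≤-refl

≼-trans : ∀ {x y z} → x ≼ y → y ≼ z → x ≼ z
≼-trans {x} {y} {z} (wrap x≤y) (wrap y≤z) = wrap λ ε 0<ε →
  let M , h = x≤y (½ ℚ.* ε) (0<½* 0<ε)
      N , k = y≤z (½ ℚ.* ε) (0<½* 0<ε)
  in M ⊔ N , λ n M⊔N≤n → begin-strict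
    seq x n                            <⟨ h n (ℕ.m⊔n≤o⇒m≤o M N M⊔N≤n) ⟩
    seq y n ℚ.+ ½ ℚ.* ε                <⟨ ℚ.+-monoˡ-< (½ ℚ.* ε) (k n (ℕ.m⊔n≤o⇒n≤o M N M⊔N≤n)) ⟩
    seq z n ℚ.+ ½ ℚ.* ε ℚ.+ ½ ℚ.* ε    ≡⟨ ℚ.+-assoc (seq z n) _ _ ⟩
    seq z n ℚ.+ (½ ℚ.* ε ℚ.+ ½ ℚ.* ε)  ≡⟨ cong (seq z n ℚ.+_) (½*+½* ε) ⟩
    seq z n ℚ.+ ε                      ∎
  where open ℚ.≤-Reasoning

+-mono-≼ : ∀ {x y z w} → x ≼ y → z ≼ w → x +ʳ z ≼ y +ʳ w
+-mono-≼ {x} {y} {z} {w} (wrap x≤y) (wrap z≤w) = wrap λ ε 0<ε →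
  let M , h = x≤y (½ ℚ.* ε) (0<½* 0<ε)
      N , k = z≤w (½ ℚ.* ε) (0<½* 0<ε)
  in M ⊔ N , λ n M⊔N≤n → begin-strict
    seq x n ℚ.+ seq z n
      <⟨ ℚ.+-mono-< (h n (ℕ.m⊔n≤o⇒m≤o M N M⊔N≤n)) (k n (ℕ.m⊔n≤o⇒n≤o M N M⊔N≤n)) ⟩
    (seq y n ℚ.+ ½ ℚ.* ε) ℚ.+ (seq w n ℚ.+ ½ ℚ.* ε)
      ≡⟨ interchange (seq y n) (½ ℚ.* ε) (seq w n) (½ ℚ.* ε) ⟩
    (seq y n ℚ.+ seq w n) ℚ.+ (½ ℚ.* ε ℚ.+ ½ ℚ.* ε)
      ≡⟨ cong (seq y n ℚ.+ seq w n ℚ.+_) (½*+½* ε) ⟩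
    seq y n ℚ.+ seq w n ℚ.+ ε ∎
  where
  open ℚ.≤-Reasoning
  interchange : ∀ a b c d → (a ℚ.+ b) ℚ.+ (c ℚ.+ d) ≡ (a ℚ.+ c) ℚ.+ (b ℚ.+ d)
  interchange = solve 4 (λ a b c d → (a :+ b) :+ (c :+ d) := (a :+ c) :+ (b :+ d)) refl
    where open +-*-Solver

-‿anti-≼ : ∀ {x y} → x ≼ y → -ʳ y ≼ -ʳ x
-‿anti-≼ {x} {y} (wrap x≤y) = wrap λ ε 0<ε → let N , h = x≤y ε 0<ε in N , λ n N≤n →
  subst₂ ℚ._<_ (lhs (seq x n) (seq y n)) (rhs (seq x n) (seq y n) ε)
    (ℚ.+-monoˡ-< (ℚ.- seq x n ℚ.- seq y n) (h n N≤n))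
  where
  open +-*-Solver
  lhs : ∀ a b → a ℚ.+ (ℚ.- a ℚ.- b) ≡ ℚ.- b
  lhs = solve 2 (λ a b → a :+ (:- a :- b) := :- b) refl
  rhs : ∀ a b c → (b ℚ.+ c) ℚ.+ (ℚ.- a ℚ.- b) ≡ ℚ.- a ℚ.+ c
  rhs = solve 3 (λ a b c → (b :+ c) :+ (:- a :- b) := :- a :+ c) refl

≋⇒≼ : ∀ {x y} → x ≋ y → x ≼ y
≋⇒≼ {x} {y} (wrap x≈y) = wrap λ ε 0<ε → let N , h = x≈y ε 0<ε in N , λ n N≤n → begin-strict
  seq x n                                ≡⟨ recover (seq x n) (seq y n) ⟩
  seq y n ℚ.+ (seq x n ℚ.- seq y n)      ≤⟨ ℚ.+-monoʳ-≤ (seq y n) (p≤∣p∣ _) ⟩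
  seq y n ℚ.+ ℚ.∣ seq x n ℚ.- seq y n ∣  <⟨ ℚ.+-monoʳ-< (seq y n) (h n N≤n) ⟩
  seq y n ℚ.+ ε                          ∎
  where
  open ℚ.≤-Reasoning
  recover : ∀ a b → a ≡ b ℚ.+ (a ℚ.- b)
  recover = solve 2 (λ a b → a := b :+ (a :- b)) refl
    where open +-*-Solver

≋-sym : ∀ {x y} → x ≋ y → y ≋ x
≋-sym {x} {y} (wrap x≈y) = wrap λ ε 0<ε → let N , h = x≈y ε 0<ε in N , λ n N≤n →
  subst (ℚ._< ε) (flip (seq x n) (seq y n)) (h n N≤n)
  where
  open +-*-Solver
  flip : ∀ a b → ℚ.∣ a ℚ.- b ∣ ≡ ℚ.∣ b ℚ.- a ∣
  flip a b = trans (sym (ℚ.∣-p∣≡∣p∣ (a ℚ.- b)))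
    (cong ℚ.∣_∣ (solve 2 (λ a b → :- (a :- b) := b :- a) refl a b))

≋⇒≽ : ∀ {x y} → x ≋ y → y ≼ x
≋⇒≽ x≈y = ≋⇒≼ (≋-sym x≈y)

≼-antisym : ∀ {x y} → x ≼ y → y ≼ x → x ≋ y
≼-antisym {x} {y} (wrap x≤y) (wrap y≤x) = wrap λ ε 0<ε →
  let M , h = x≤y ε 0<ε
      N , k = y≤x ε 0<ε
  in M ⊔ N , λ n M⊔N≤n → bound ε (seq x n) (seq y n)
      (h n (ℕ.m⊔n≤o⇒m≤o M N M⊔N≤n)) (k n (ℕ.m⊔n≤o⇒n≤o M N M⊔N≤n))
  where
  open +-*-Solver
  cancel : ∀ a b → (b ℚ.+ a) ℚ.- b ≡ a
  cancel = solve 2 (λ a b → (b :+ a) :- b := a) refl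
  bound : ∀ ε a b → a ℚ.< b ℚ.+ ε → b ℚ.< a ℚ.+ ε → ℚ.∣ a ℚ.- b ∣ ℚ.< ε
  bound ε a b a<b+ε b<a+ε with ℚ.∣p∣≡p∨∣p∣≡-p (a ℚ.- b)
  ... | inj₁ eq = subst₂ ℚ._<_ (sym eq) (cancel ε b) (ℚ.+-monoˡ-< (ℚ.- b) a<b+ε)
  ... | inj₂ eq = subst₂ ℚ._<_
    (trans (solve 2 (λ a b → b :- a := :- (a :- b)) refl a b) (sym eq)) (cancel ε a)
    (ℚ.+-monoˡ-< (ℚ.- a) b<a+ε)

≋-pointwise : ∀ {x y} → (∀ n → seq x n ≡ seq y n) → x ≋ y
≋-pointwise h = ≼-antisym
  (≼-pointwise λ n → ℚ.≤-reflexive (h n)) (≼-pointwise λ n → ℚ.≤-reflexive (sym (h n)))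

≋-trans : ∀ {x y z} → x ≋ y → y ≋ z → x ≋ z
≋-trans x≈y y≈z = ≼-antisym (≼-trans (≋⇒≼ x≈y) (≋⇒≼ y≈z)) (≼-trans (≋⇒≽ y≈z) (≋⇒≽ x≈y))

+-cong-≋ : ∀ {x y z w} → x ≋ y → z ≋ w → x +ʳ z ≋ y +ʳ w
+-cong-≋ x≈y z≈w = ≼-antisym (+-mono-≼ (≋⇒≼ x≈y) (≋⇒≼ z≈w)) (+-mono-≼ (≋⇒≽ x≈y) (≋⇒≽ z≈w))

-‿cong-≋ : ∀ {x y} → x ≋ y → -ʳ x ≋ -ʳ y
-‿cong-≋ x≈y = ≼-antisym (-‿anti-≼ (≋⇒≽ x≈y)) (-‿anti-≼ (≋⇒≼ x≈y))

-- From some index on, all terms lie within 1 of a fixed one. This is what makes multiplication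
-- respect `_≋_`.
eventually-bounded : ∀ x → ∃[ B ] (0ℚ ℚ.< B × ∃[ N ] (∀ n → N ≤ n → ℚ.∣ seq x n ∣ ℚ.≤ B))
eventually-bounded x with N , h ← cauchy x 1ℚ (ℚ.positive⁻¹ 1ℚ)
  = ℚ.∣ seq x N ∣ ℚ.+ 1ℚ
  , ℚ.+-mono-≤-< (ℚ.0≤∣p∣ (seq x N)) (ℚ.positive⁻¹ 1ℚ)
  , N
  , λ n N≤n → begin
    ℚ.∣ seq x n ∣                                      ≡⟨ cong ℚ.∣_∣ (recover (seq x n) (seq x N)) ⟩
    ℚ.∣ seq x N ℚ.+ (seq x n ℚ.- seq x N) ∣            ≤⟨ ℚ.∣p+q∣≤∣p∣+∣q∣ (seq x N) _ ⟩
    ℚ.∣ seq x N ∣ ℚ.+ ℚ.∣ seq x n ℚ.- seq x N ∣        ≤⟨ ℚ.+-monoʳ-≤ ℚ.∣ seq x N ∣ (ℚ.<⇒≤ (h n N N≤n ℕ.≤-refl)) ⟩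
    ℚ.∣ seq x N ∣ ℚ.+ 1ℚ                               ∎
  where
  open ℚ.≤-Reasoning
  recover : ∀ a b → a ≡ b ℚ.+ (a ℚ.- b)
  recover = solve 2 (λ a b → a := b :+ (a :- b)) refl
    where open +-*-Solver

*-congˡ-≋ : ∀ {x y z} → y ≋ z → x *ʳ y ≋ x *ʳ z
*-congˡ-≋ {x} {y} {z} (wrap y≈z) = wrap λ ε 0<ε →
  let N , close = y≈z (B⁻¹ ℚ.* ε) (ℚ.positive⁻¹ _
        {{ℚ.pos*pos⇒pos B⁻¹ {{ℚ.1/pos⇒pos B {{ℚ.positive 0<B}}}} ε {{ℚ.positive 0<ε}}}})
  in M ⊔ N , λ n M⊔N≤n → begin-strict
    ℚ.∣ seq x n ℚ.* seq y n ℚ.- seq x n ℚ.* seq z n ∣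
      ≡⟨ cong ℚ.∣_∣ (factor (seq x n) (seq y n) (seq z n)) ⟩
    ℚ.∣ seq x n ℚ.* (seq y n ℚ.- seq z n) ∣
      ≡⟨ ℚ.∣p*q∣≡∣p∣*∣q∣ (seq x n) _ ⟩
    ℚ.∣ seq x n ∣ ℚ.* ℚ.∣ seq y n ℚ.- seq z n ∣
      ≤⟨ ℚ.*-monoʳ-≤-nonNeg _ {{ℚ.nonNegative (ℚ.0≤∣p∣ (seq y n ℚ.- seq z n))}} (h n (ℕ.m⊔n≤o⇒m≤o M N M⊔N≤n)) ⟩
    B ℚ.* ℚ.∣ seq y n ℚ.- seq z n ∣
      <⟨ ℚ.*-monoʳ-<-pos B {{ℚ.positive 0<B}} (close n (ℕ.m⊔n≤o⇒n≤o M N M⊔N≤n)) ⟩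
    B ℚ.* (B⁻¹ ℚ.* ε)
      ≡⟨ ℚ.*-assoc B B⁻¹ ε ⟨
    B ℚ.* B⁻¹ ℚ.* ε
      ≡⟨ cong (ℚ._* ε) (ℚ.*-inverseʳ B {{B≢0}}) ⟩
    1ℚ ℚ.* ε
      ≡⟨ ℚ.*-identityˡ ε ⟩
    ε ∎
  where
  open ℚ.≤-Reasoning
  bounded = eventually-bounded x
  B = proj₁ bounded
  0<B = proj₁ (proj₂ bounded)
  M = proj₁ (proj₂ (proj₂ bounded))
  h = proj₂ (proj₂ (proj₂ bounded))
  B≢0 : ℚ.NonZero B
  B≢0 = ℚ.pos⇒nonZero B {{ℚ.positive 0<B}}
  B⁻¹ : ℚ
  B⁻¹ = (ℚ.1/ B) {{B≢0}}
  factor : ∀ a b c → a ℚ.* b ℚ.- a ℚ.* c ≡ a ℚ.* (b ℚ.- c)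
  factor = solve 3 (λ a b c → a :* b :- a :* c := a :* (b :- c)) refl
    where open +-*-Solver

*-comm-≋ : ∀ x y → x *ʳ y ≋ y *ʳ x
*-comm-≋ x y = ≋-pointwise λ n → ℚ.*-comm (seq x n) (seq y n)

*-cong-≋ : ∀ {x y z w} → x ≋ y → z ≋ w → x *ʳ z ≋ y *ʳ w
*-cong-≋ {x} {y} {z} {w} x≈y z≈w = ≋-trans (*-congˡ-≋ z≈w)
  (≋-trans (*-comm-≋ x w) (≋-trans (*-congˡ-≋ x≈y) (*-comm-≋ w y)))

ℝ-commutativeRing : CommutativeRing 0ℓ 0ℓ
ℝ-commutativeRing = record
  { Carrier = ℝ ; _≈_ = _≋_ ; _+_ = _+ʳ_ ; _*_ = _*ʳ_ ; -_ = -ʳ_ ; 0# = 0ʳ ; 1# = 1ʳ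
  ; isCommutativeRing = record
    { isRing = record
      { +-isAbelianGroup = record
        { isGroup = record
          { isMonoid = record
            { isSemigroup = record
              { isMagma = record
                { isEquivalence = record
                  { refl = ≋-pointwise λ _ → refl ; sym = ≋-sym ; trans = ≋-trans }
                ; ∙-cong = +-cong-≋
                }
              ; assoc = λ x y z → ≋-pointwise λ n → ℚ.+-assoc (seq x n) (seq y n) (seq z n)
              }
            ; identity = (λ x → ≋-pointwise λ n → ℚ.+-identityˡ (seq x n))
                       , (λ x → ≋-pointwise λ n → ℚ.+-identityʳ (seq x n))
            }
          ; inverse = (λ x → ≋-pointwise λ n → ℚ.+-inverseˡ (seq x n))
                    , (λ x → ≋-pointwise λ n → ℚ.+-inverseʳ (seq x n))
          ; ⁻¹-cong = -‿cong-≋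
          }
        ; comm = λ x y → ≋-pointwise λ n → ℚ.+-comm (seq x n) (seq y n)
        }
      ; *-cong = *-cong-≋
      ; *-assoc = λ x y z → ≋-pointwise λ n → ℚ.*-assoc (seq x n) (seq y n) (seq z n)
      ; *-identity = (λ x → ≋-pointwise λ n → ℚ.*-identityˡ (seq x n))
                   , (λ x → ≋-pointwise λ n → ℚ.*-identityʳ (seq x n))
      ; distrib = (λ x y z → ≋-pointwise λ n → ℚ.*-distribˡ-+ (seq x n) (seq y n) (seq z n))
                , (λ x y z → ≋-pointwise λ n → ℚ.*-distribʳ-+ (seq x n) (seq y n) (seq z n))
      }
    ; *-comm = *-comm-≋
    }
  }

module R where
  open CommutativeRing ℝ-commutativeRing public
    using (setoid; isEquivalence; semiring; +-cong; *-cong; -‿cong; *-comm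
          ; *-identityˡ; +-identityˡ; +-identityʳ; reflexive)
    renaming (refl to ≋-refl)

fromℚ-≟ : ∀ p q → Maybe (fromℚ p ≋ fromℚ q)
fromℚ-≟ p q with p ℚ.≟ q
... | yes p≡q = just (R.reflexive (cong fromℚ p≡q))
... | no _    = nothing

-- With rational coefficients the ring solver computes with constants such as 4 or ¾ instead of
-- treating them as variables.
fromℚ-homomorphism :
  CommutativeRing.rawRing ℚ.+-*-commutativeRing ACR.-Raw-AlmostCommutative⟶ ACR.fromCommutativeRing ℝ-commutativeRing
fromℚ-homomorphism = record
  { ⟦_⟧    = fromℚ
  ; +-homo = λ p q → ≋-pointwise λ _ → refl
  ; *-homo = λ p q → ≋-pointwise λ _ → refl
  ; -‿homo = λ p → ≋-pointwise λ _ → refl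
  ; 0-homo = ≋-pointwise λ _ → refl
  ; 1-homo = ≋-pointwise λ _ → refl
  }

module ℝ-Solver = RingSolver _ _ fromℚ-homomorphism fromℚ-≟

-- If `x ≤ʳ y` fails at some ε, then x - y, which settles to within ε/2, stays at least ε/2 from
-- some index on, and this yields `y ≤ʳ x` against the assumption.
≼-total : ExcludedMiddle 0ℓ → ∀ x y → x ≼ y ⊎ y ≼ x
≼-total em x y with em {y ≼ x}
... | yes y≤x = inj₂ y≤x
... | no  y≰x = inj₁ (wrap below)
  where
  open ℚ.≤-Reasoning
  open +-*-Solver
  cancel : ∀ a b → a ≡ b ℚ.+ (a ℚ.- b)
  cancel = solve 2 (λ a b → a := b :+ (a :- b)) refl
  below : x ≤ʳ y
  below ε 0<ε with em {∃[ N ] (∀ n → N ≤ n → seq x n ℚ.< seq y n ℚ.+ ε)}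
  ... | yes close = close
  ... | no ¬close = contradiction (wrap y≤x) y≰x
    where
    δ = ½ ℚ.* ε
    N = proj₁ (cauchy (x -ʳ y) δ (0<½* 0<ε))
    steady = proj₂ (cauchy (x -ʳ y) δ (0<½* 0<ε))
    -- x − y is within δ of constant from N on, so one value below δ would make it small for good.
    apart : ∀ n → N ≤ n → δ ℚ.≤ seq x n ℚ.- seq y n
    apart n N≤n = ℚ.≮⇒≥ λ d<δ → ¬close (N , λ k N≤k → begin-strict
      seq x k
        ≡⟨ cancel (seq x k) (seq y k) ⟩
      seq y k ℚ.+ (seq x k ℚ.- seq y k)
        ≡⟨ cong (seq y k ℚ.+_) (cancel _ (seq x n ℚ.- seq y n)) ⟩
      seq y k ℚ.+ ((seq x n ℚ.- seq y n) ℚ.+ ((seq x k ℚ.- seq y k) ℚ.- (seq x n ℚ.- seq y n)))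
        <⟨ ℚ.+-monoʳ-< (seq y k) (ℚ.+-mono-<-≤ d<δ (p≤∣p∣ _)) ⟩
      seq y k ℚ.+ (δ ℚ.+ ℚ.∣ (seq x k ℚ.- seq y k) ℚ.- (seq x n ℚ.- seq y n) ∣)
        <⟨ ℚ.+-monoʳ-< (seq y k) (ℚ.+-monoʳ-< δ (steady k n N≤k N≤n)) ⟩
      seq y k ℚ.+ (δ ℚ.+ δ)
        ≡⟨ cong (seq y k ℚ.+_) (½*+½* ε) ⟩
      seq y k ℚ.+ ε ∎)
    y≤x : y ≤ʳ x
    y≤x η 0<η = N , λ n N≤n → begin-strict
      seq y n                                ≡⟨ ℚ.+-identityʳ (seq y n) ⟨
      seq y n ℚ.+ 0ℚ                         <⟨ ℚ.+-monoʳ-< (seq y n) (ℚ.<-≤-trans (0<½* 0<ε) (apart n N≤n)) ⟩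
      seq y n ℚ.+ (seq x n ℚ.- seq y n)      ≡⟨ cancel (seq x n) (seq y n) ⟨
      seq x n                                ≡⟨ ℚ.+-identityʳ (seq x n) ⟨
      seq x n ℚ.+ 0ℚ                         <⟨ ℚ.+-monoʳ-< (seq x n) 0<η ⟩
      seq x n ℚ.+ η                          ∎

≼-preorder : Preorder 0ℓ 0ℓ 0ℓ
≼-preorder = record
  { Carrier = ℝ ; _≈_ = _≋_ ; _≲_ = _≼_
  ; isPreorder = record { isEquivalence = R.isEquivalence ; reflexive = ≋⇒≼ ; trans = ≼-trans }
  }

module ≼-Reasoning = PreorderReasoning ≼-preorder

module ≋-Reasoning = SetoidReasoning R.setoid

0≼x*x : ∀ x → 0ʳ ≼ x *ʳ x
0≼x*x x = ≼-pointwise λ n → 0≤p*p (seq x n)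

open import Algebra.Properties.Semiring.Sum R.semiring
  using (sum-cong-≋; ∑-distrib-+; ∑-comm; *-distribˡ-sum; *-distribʳ-sum; sum-replicate
        ; sum-replicate-zero; sum-init-last; sum-remove)
open import Algebra.Properties.Semiring.Mult R.semiring
  using (×-congʳ; ×1-homo-*; ×-assoc-*) renaming (_×_ to _·_)

-- Sums

sumʳ-cong : ∀ {n} {f g : Vector ℝ n} → (∀ i → f i ≋ g i) → sumʳ f ≋ sumʳ g
sumʳ-cong eq = sum-cong-≋ eq

-- The conclusion has the form of the hypothesis, so the lemma can be nested over the row and the
-- column index of a matrix.
sum-linear : ∀ {n} c {f g h : Vector ℝ n} →
  (∀ i → f i ≋ g i +ʳ c *ʳ h i) → sumʳ f ≋ sumʳ g +ʳ c *ʳ sumʳ h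
sum-linear c {f} {g} {h} eq = ≋-trans (sumʳ-cong eq) (≋-trans (∑-distrib-+ g (λ i → c *ʳ h i))
  (R.+-cong R.≋-refl (≋-sym (*-distribˡ-sum c h))))

sum-nonneg : ∀ {n} {f : Vector ℝ n} → (∀ i → 0ʳ ≼ f i) → 0ʳ ≼ sumʳ f
sum-nonneg {zero}  0≤f = ≼-refl
sum-nonneg {suc n} 0≤f = ≼-trans (≋⇒≽ (R.+-identityˡ 0ʳ)) (+-mono-≼ (0≤f zero) (sum-nonneg (λ i → 0≤f (suc i))))

sum-single : ∀ {n} (k : Fin n) (f : Vector ℝ n) → (∀ i → i ≢ k → f i ≋ 0ʳ) → sumʳ f ≋ f k
sum-single {suc n} k f eq = ≋-trans (sum-remove f)
  (≋-trans (R.+-cong R.≋-refl (≋-trans (sumʳ-cong λ i → eq _ (Fin.punchInᵢ≢i k i)) (sum-replicate-zero n)))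
    (R.+-identityʳ (f k)))

-- Grows at the last index, as the loops of the machine do, whereas `sumʳ` splits off the first.
Σ< : ℕ → (ℕ → ℝ) → ℝ
Σ< zero    f = 0ʳ
Σ< (suc n) f = Σ< n f +ʳ f n

sum≋Σ< : ∀ {n} {f : Vector ℝ n} g → (∀ i → f i ≋ g (toℕ i)) → sumʳ f ≋ Σ< n g
sum≋Σ< {zero}      g eq = R.≋-refl
sum≋Σ< {suc n} {f} g eq = ≋-trans (sum-init-last f) (R.+-cong
  (sum≋Σ< g λ i → ≋-trans (eq (inject₁ i)) (R.reflexive (cong g (Fin.toℕ-inject₁ i))))
  (≋-trans (eq (fromℕ n)) (R.reflexive (cong g (Fin.toℕ-fromℕ n)))))

Σ<-cong : ∀ n {f g : ℕ → ℝ} → (∀ i → i < n → f i ≋ g i) → Σ< n f ≋ Σ< n g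
Σ<-cong zero    eq = R.≋-refl
Σ<-cong (suc n) eq = R.+-cong (Σ<-cong n λ i i<n → eq i (ℕ.m<n⇒m<1+n i<n)) (eq n ℕ.≤-refl)

re-sumᶜ : ∀ {n} (f : Vector ℂ n) → re (sumᶜ f) ≡ sumʳ (λ i → re (f i))
re-sumᶜ {zero}  f = refl
re-sumᶜ {suc n} f = cong (re (f zero) +ʳ_) (re-sumᶜ (λ i → f (suc i)))

im-sumᶜ : ∀ {n} (f : Vector ℂ n) → im (sumᶜ f) ≡ sumʳ (λ i → im (f i))
im-sumᶜ {zero}  f = refl
im-sumᶜ {suc n} f = cong (im (f zero) +ʳ_) (im-sumᶜ (λ i → f (suc i)))

-- Complex matrices as a real inner product space

Matrix : ℕ → Set
Matrix d = Fin d → Fin d → ℂ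

-- The real part of the Hilbert-Schmidt product tr(AB*), that is, the Euclidean inner product on
-- ℝ^(2d²).
⟪_,_⟫ : ∀ {d} → Matrix d → Matrix d → ℝ
⟪ A , B ⟫ = sumʳ λ k → sumʳ λ l → re (A k l) *ʳ re (B k l) +ʳ im (A k l) *ʳ im (B k l)

_⊕[_]_ : ∀ {d} → Matrix d → ℝ → Matrix d → Matrix d
(A ⊕[ c ] B) k l = (re (A k l) +ʳ c *ʳ re (B k l)) +i (im (A k l) +ʳ c *ʳ im (B k l))

0ᴹ : ∀ {d} → Matrix d
0ᴹ k l = 0ᶜ

⟪⟫-comm : ∀ {d} (A B : Matrix d) → ⟪ A , B ⟫ ≋ ⟪ B , A ⟫
⟪⟫-comm A B = sumʳ-cong λ k → sumʳ-cong λ l → R.+-cong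
  (R.*-comm (re (A k l)) (re (B k l))) (R.*-comm (im (A k l)) (im (B k l)))

⟪⟫-linearˡ : ∀ {d} (A : Matrix d) c B C → ⟪ A ⊕[ c ] B , C ⟫ ≋ ⟪ A , C ⟫ +ʳ c *ʳ ⟪ B , C ⟫
⟪⟫-linearˡ A c B C = sum-linear c λ k → sum-linear c λ l →
  identity (re (A k l)) (im (A k l)) (re (B k l)) (im (B k l)) (re (C k l)) (im (C k l)) c
  where
  open ℝ-Solver
  identity : ∀ a a′ b b′ x x′ c →
    (a +ʳ c *ʳ b) *ʳ x +ʳ (a′ +ʳ c *ʳ b′) *ʳ x′ ≋ (a *ʳ x +ʳ a′ *ʳ x′) +ʳ c *ʳ (b *ʳ x +ʳ b′ *ʳ x′)
  identity = solve 7 (λ a a′ b b′ x x′ c →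
    (a :+ c :* b) :* x :+ (a′ :+ c :* b′) :* x′ := (a :* x :+ a′ :* x′) :+ c :* (b :* x :+ b′ :* x′))
    R.≋-refl

⟪⟫-zeroˡ : ∀ {d} (A : Matrix d) → ⟪ 0ᴹ , A ⟫ ≋ 0ʳ
⟪⟫-zeroˡ {d} A = ≋-trans (sumʳ-cong λ k → ≋-trans
  (sumʳ-cong λ l → solve 2 (λ x y → con 0ℚ :* x :+ con 0ℚ :* y := con 0ℚ) R.≋-refl (re (A k l)) (im (A k l)))
  (sum-replicate-zero d)) (sum-replicate-zero d)
  where open ℝ-Solver

⟪⟫-nonneg : ∀ {d} (A : Matrix d) → 0ʳ ≼ ⟪ A , A ⟫
⟪⟫-nonneg A = sum-nonneg λ k → sum-nonneg λ l →
  ≼-trans (≋⇒≽ (R.+-identityˡ 0ʳ)) (+-mono-≼ (0≼x*x (re (A k l))) (0≼x*x (im (A k l))))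

⟪⟫-square : ∀ {d} (A : Matrix d) c B →
  ⟪ A ⊕[ c ] B , A ⊕[ c ] B ⟫ ≋
  ⟪ A , A ⟫ +ʳ c *ʳ (⟪ A , B ⟫ +ʳ ⟪ A , B ⟫) +ʳ c *ʳ c *ʳ ⟪ B , B ⟫
⟪⟫-square A c B = begin
  ⟪ A ⊕[ c ] B , A ⊕[ c ] B ⟫
    ≈⟨ ⟪⟫-linearˡ A c B (A ⊕[ c ] B) ⟩
  ⟪ A , A ⊕[ c ] B ⟫ +ʳ c *ʳ ⟪ B , A ⊕[ c ] B ⟫
    ≈⟨ R.+-cong (expand A) (R.*-cong R.≋-refl (expand B)) ⟩
  (⟪ A , A ⟫ +ʳ c *ʳ ⟪ B , A ⟫) +ʳ c *ʳ (⟪ A , B ⟫ +ʳ c *ʳ ⟪ B , B ⟫)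
    ≈⟨ R.+-cong (R.+-cong R.≋-refl (R.*-cong R.≋-refl (⟪⟫-comm B A))) R.≋-refl ⟩
  (⟪ A , A ⟫ +ʳ c *ʳ ⟪ A , B ⟫) +ʳ c *ʳ (⟪ A , B ⟫ +ʳ c *ʳ ⟪ B , B ⟫)
    ≈⟨ solve 4 (λ a b e c → (a :+ c :* b) :+ c :* (b :+ c :* e) := a :+ c :* (b :+ b) :+ c :* c :* e)
         R.≋-refl ⟪ A , A ⟫ ⟪ A , B ⟫ ⟪ B , B ⟫ c ⟩
  ⟪ A , A ⟫ +ʳ c *ʳ (⟪ A , B ⟫ +ʳ ⟪ A , B ⟫) +ʳ c *ʳ c *ʳ ⟪ B , B ⟫ ∎
  where
  open ≋-Reasoning
  open ℝ-Solver
  expand : ∀ C → ⟪ C , A ⊕[ c ] B ⟫ ≋ ⟪ A , C ⟫ +ʳ c *ʳ ⟪ B , C ⟫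
  expand C = ≋-trans (⟪⟫-comm C (A ⊕[ c ] B)) (⟪⟫-linearˡ A c B C)

outer : ∀ {d} → Vector ℂ d → Matrix d
outer v k l = v k *ᶜ conj (v l)

sum*sum : ∀ {n} (f g : Vector ℝ n) → sumʳ f *ʳ sumʳ g ≋ sumʳ λ k → sumʳ λ l → f k *ʳ g l
sum*sum f g = ≋-trans (*-distribʳ-sum (sumʳ g) f) (sumʳ-cong λ k → *-distribˡ-sum (f k) g)

-- Multiplying out the squares of both parts of ⟨v, w⟩ gives double sums that agree with the left
-- side at every (k, l): conj(vₖ)wₖ times the conjugate of conj(vₗ)wₗ is conj(vₖ conj(vₗ)) times wₖ
-- conj(wₗ).
⟪outer,outer⟫ : ∀ {d} (v w : Vector ℂ d) → ⟪ outer v , outer w ⟫ ≋ ∣ ⟨ v , w ⟩ ∣²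
⟪outer,outer⟫ v w = ≋-sym (begin
  ∣ ⟨ v , w ⟩ ∣²
    ≡⟨ cong₂ (λ x y → x *ʳ x +ʳ y *ʳ y) (re-sumᶜ λ k → conj (v k) *ᶜ w k) (im-sumᶜ λ k → conj (v k) *ᶜ w k) ⟩
  sumʳ a *ʳ sumʳ a +ʳ sumʳ b *ʳ sumʳ b
    ≈⟨ R.+-cong (sum*sum a a) (sum*sum b b) ⟩
  (sumʳ λ k → sumʳ λ l → a k *ʳ a l) +ʳ (sumʳ λ k → sumʳ λ l → b k *ʳ b l)
    ≈⟨ ∑-distrib-+ (λ k → sumʳ λ l → a k *ʳ a l) (λ k → sumʳ λ l → b k *ʳ b l) ⟨
  (sumʳ λ k → (sumʳ λ l → a k *ʳ a l) +ʳ (sumʳ λ l → b k *ʳ b l))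
    ≈⟨ sumʳ-cong (λ k → ≋-trans (≋-sym (∑-distrib-+ (λ l → a k *ʳ a l) (λ l → b k *ʳ b l)))
         (sumʳ-cong λ l → identity (re (v k)) (im (v k)) (re (v l)) (im (v l)) (re (w k)) (im (w k)) (re (w l)) (im (w l)))) ⟩
  ⟪ outer v , outer w ⟫ ∎)
  where
  open ≋-Reasoning
  open ℝ-Solver
  a b : Vector ℝ _
  a k = re (conj (v k) *ᶜ w k)
  b k = im (conj (v k) *ᶜ w k)
  identity : ∀ p p′ q q′ x x′ y y′ →
    (p *ʳ x -ʳ -ʳ p′ *ʳ x′) *ʳ (q *ʳ y -ʳ -ʳ q′ *ʳ y′) +ʳ (p *ʳ x′ +ʳ -ʳ p′ *ʳ x) *ʳ (q *ʳ y′ +ʳ -ʳ q′ *ʳ y)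
    ≋ (p *ʳ q -ʳ p′ *ʳ -ʳ q′) *ʳ (x *ʳ y -ʳ x′ *ʳ -ʳ y′) +ʳ (p *ʳ -ʳ q′ +ʳ p′ *ʳ q) *ʳ (x *ʳ -ʳ y′ +ʳ x′ *ʳ y)
  identity = solve 8 (λ p p′ q q′ x x′ y y′ →
    (p :* x :- (:- p′) :* x′) :* (q :* y :- (:- q′) :* y′) :+ (p :* x′ :+ (:- p′) :* x) :* (q :* y′ :+ (:- q′) :* y)
    := (p :* q :- p′ :* (:- q′)) :* (x :* y :- x′ :* (:- y′)) :+ (p :* (:- q′) :+ p′ :* q) :* (x :* (:- y′) :+ x′ :* y))
    R.≋-refl

∣⟨v,v⟩∣²≋‖v‖²*‖v‖² : ∀ {d} (v : Vector ℂ d) → ∣ ⟨ v , v ⟩ ∣² ≋ ‖ v ‖² *ʳ ‖ v ‖²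
∣⟨v,v⟩∣²≋‖v‖²*‖v‖² {d} v = begin
  ∣ ⟨ v , v ⟩ ∣²
    ≡⟨ cong₂ (λ x y → x *ʳ x +ʳ y *ʳ y) (re-sumᶜ λ k → conj (v k) *ᶜ v k) (im-sumᶜ λ k → conj (v k) *ᶜ v k) ⟩
  sumʳ a *ʳ sumʳ a +ʳ sumʳ b *ʳ sumʳ b
    ≈⟨ R.+-cong (R.*-cong a≋ a≋) (R.*-cong b≋ b≋) ⟩
  ‖ v ‖² *ʳ ‖ v ‖² +ʳ 0ʳ *ʳ 0ʳ
    ≈⟨ solve 1 (λ x → x :* x :+ con 0ℚ :* con 0ℚ := x :* x) R.≋-refl ‖ v ‖² ⟩
  ‖ v ‖² *ʳ ‖ v ‖² ∎
  where
  open ≋-Reasoning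
  open ℝ-Solver
  a b : Vector ℝ _
  a k = re (conj (v k) *ᶜ v k)
  b k = im (conj (v k) *ᶜ v k)
  a≋ : sumʳ a ≋ ‖ v ‖²
  a≋ = sumʳ-cong λ k → solve 2 (λ x y → x :* x :- (:- y) :* y := x :* x :+ y :* y) R.≋-refl (re (v k)) (im (v k))
  b≋ : sumʳ b ≋ 0ʳ
  b≋ = ≋-trans (sumʳ-cong λ k → solve 2 (λ x y → x :* y :+ (:- y) :* x := con 0ℚ) R.≋-refl (re (v k)) (im (v k)))
    (sum-replicate-zero d)

-- The frame hypothesis

basis : ∀ {d} → Fin d → Vector ℂ d
basis k j with k ≟ j
... | yes _ = 1ʳ +i 0ʳ
... | no  _ = 0ᶜ

basis-diag : ∀ {d} (k : Fin d) → basis k k ≡ 1ʳ +i 0ʳ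
basis-diag k with k ≟ k
... | yes _  = refl
... | no k≢k = contradiction refl k≢k

basis-off : ∀ {d} (k j : Fin d) → j ≢ k → basis k j ≡ 0ᶜ
basis-off k j j≢k with k ≟ j
... | yes k≡j = contradiction (sym k≡j) j≢k
... | no _    = refl

basis-unit : ∀ {d} (k : Fin d) → IsUnit (basis k)
basis-unit k = ≋⇒≈ʳ {y = 1ʳ} (≋-trans
  (sum-single k (λ j → ∣ basis k j ∣²) λ j j≢k →
    ≋-trans (R.reflexive (cong ∣_∣² (basis-off k j j≢k))) (≋-pointwise λ _ → refl))
  (≋-trans (R.reflexive (cong ∣_∣² (basis-diag k))) (≋-pointwise λ _ → refl)))

∣⟨basis,v⟩∣² : ∀ {d} (k : Fin d) (v : Vector ℂ d) → ∣ ⟨ basis k , v ⟩ ∣² ≋ ∣ v k ∣²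
∣⟨basis,v⟩∣² k v = ≋-trans
  (R.reflexive (cong₂ (λ x y → x *ʳ x +ʳ y *ʳ y) (re-sumᶜ term) (im-sumᶜ term)))
  (R.+-cong (R.*-cong re≋ re≋) (R.*-cong im≋ im≋))
  where
  open ℝ-Solver
  term : Vector ℂ _
  term j = conj (basis k j) *ᶜ v j
  re≋ : sumʳ (λ j → re (term j)) ≋ re (v k)
  re≋ = ≋-trans
    (sum-single k (λ j → re (term j)) λ j j≢k →
      ≋-trans (R.reflexive (cong (λ z → re (conj z *ᶜ v j)) (basis-off k j j≢k)))
        (solve 2 (λ x y → con 0ℚ :* x :- (:- con 0ℚ) :* y := con 0ℚ) R.≋-refl (re (v j)) (im (v j))))
    (≋-trans (R.reflexive (cong (λ z → re (conj z *ᶜ v k)) (basis-diag k)))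
        (solve 2 (λ x y → con 1ℚ :* x :- (:- con 0ℚ) :* y := x) R.≋-refl (re (v k)) (im (v k))))
  im≋ : sumʳ (λ j → im (term j)) ≋ im (v k)
  im≋ = ≋-trans
    (sum-single k (λ j → im (term j)) λ j j≢k →
      ≋-trans (R.reflexive (cong (λ z → im (conj z *ᶜ v j)) (basis-off k j j≢k)))
        (solve 2 (λ x y → con 0ℚ :* y :+ (:- con 0ℚ) :* x := con 0ℚ) R.≋-refl (re (v j)) (im (v j))))
    (≋-trans (R.reflexive (cong (λ z → im (conj z *ᶜ v k)) (basis-diag k)))
        (solve 2 (λ x y → con 1ℚ :* y :+ (:- con 0ℚ) :* x := y) R.≋-refl (re (v k)) (im (v k))))

-- The trace is taken by testing the frame identity on the standard basis and exchanging the two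
-- sums.
m·α≋d : ∀ {d m} (v : Fin m → Vector ℂ d) {α} →
  (∀ (u : Vector ℂ d) → IsUnit u → sumʳ (λ i → ∣ ⟨ u , v i ⟩ ∣²) ≋ 1ʳ) →
  (∀ i → ‖ v i ‖² ≋ α) → m · α ≋ d · 1ʳ
m·α≋d {d} {m} v {α} frame norms = begin
  m · α                                                ≈⟨ sum-replicate m ⟨
  sumʳ {m} (λ _ → α)                                   ≈⟨ sumʳ-cong norms ⟨
  sumʳ (λ i → ‖ v i ‖²)                                ≈⟨ ∑-comm (λ i k → ∣ v i k ∣²) ⟩
  sumʳ (λ k → sumʳ λ i → ∣ v i k ∣²)                   ≈⟨ sumʳ-cong (λ k → sumʳ-cong λ i → ∣⟨basis,v⟩∣² k (v i)) ⟨
  sumʳ (λ k → sumʳ λ i → ∣ ⟨ basis k , v i ⟩ ∣²)       ≈⟨ sumʳ-cong (λ k → frame (basis k) (basis-unit k)) ⟩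
  sumʳ {d} (λ _ → 1ʳ)                                  ≈⟨ sum-replicate d ⟩
  d · 1ʳ                                               ∎
  where open ≋-Reasoning

-- Natural multiples and inequalities without division

≼⇒0≼- : ∀ {x y} → x ≼ y → 0ʳ ≼ y -ʳ x
≼⇒0≼- {x} {y} x≤y = ≼-trans (≋⇒≽ (≋-pointwise λ n → ℚ.+-inverseʳ (seq x n)))
  (+-mono-≼ x≤y ≼-refl)

0≼-⇒≼ : ∀ {x y} → 0ʳ ≼ y -ʳ x → x ≼ y
0≼-⇒≼ {x} {y} 0≤y-x = ≼-trans (≋⇒≽ (R.+-identityˡ x)) (≼-trans (+-mono-≼ 0≤y-x ≼-refl)
  (≋⇒≼ (solve 2 (λ x y → y :- x :+ x := y) R.≋-refl x y)))
  where open ℝ-Solver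

·-nonneg : ∀ n {x} → 0ʳ ≼ x → 0ʳ ≼ n · x
·-nonneg zero    0≤x = ≼-refl
·-nonneg (suc n) 0≤x = ≼-trans (≋⇒≽ (R.+-identityˡ 0ʳ)) (+-mono-≼ 0≤x (·-nonneg n 0≤x))

·-nonpos : ∀ n {x} → x ≼ 0ʳ → n · x ≼ 0ʳ
·-nonpos zero    x≤0 = ≼-refl
·-nonpos (suc n) x≤0 = ≼-trans (+-mono-≼ x≤0 (·-nonpos n x≤0)) (≋⇒≼ (R.+-identityˡ 0ʳ))

·-monoˡ : ∀ {m n x} → m ≤ n → 0ʳ ≼ x → m · x ≼ n · x
·-monoˡ {n = n} z≤n 0≤x = ·-nonneg n 0≤x
·-monoˡ (s≤s m≤n) 0≤x = +-mono-≼ ≼-refl (·-monoˡ m≤n 0≤x)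

-- Replaces division by n. If w ≤ 0, the other n - 1 copies of w only lower the multiple, so w is at
-- least `n · w`.
·-cancel-nonneg : ExcludedMiddle 0ℓ → ∀ {n w} → 1 ≤ n → 0ʳ ≼ n · w → 0ʳ ≼ w
·-cancel-nonneg em {suc n} {w} _ 0≤nw with ≼-total em 0ʳ w
... | inj₁ 0≤w = 0≤w
... | inj₂ w≤0 = ≼-trans 0≤nw (≼-trans (+-mono-≼ ≼-refl (·-nonpos n w≤0)) (≋⇒≼ (R.+-identityʳ w)))

·≋·1* : ∀ n x → n · x ≋ (n · 1ʳ) *ʳ x
·≋·1* n x = ≋-sym (≋-trans (×-assoc-* n 1ʳ x) (×-congʳ n (R.*-identityˡ x)))

-- Multiplying the gap 1 - 4mα² by m turns it into m - 4(mα)² = m - 4d².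
4mα²≼1 : ExcludedMiddle 0ℓ → ∀ {d m α} → 1 ≤ m → 4 * (d * d) ≤ m → m · α ≋ d · 1ʳ →
  fromℚ (+ 4 / 1) *ʳ (m · (α *ʳ α)) ≼ 1ʳ
4mα²≼1 em {d} {m} {α} 1≤m 4dd≤m mα≋d = 0≼-⇒≼ (·-cancel-nonneg em 1≤m (≼-trans
  (≼⇒0≼- (·-monoˡ 4dd≤m 0≼1))
  (≋⇒≽ (begin
    m · (1ʳ -ʳ four *ʳ (m · (α *ʳ α)))
      ≈⟨ ·≋·1* m _ ⟩
    M *ʳ (1ʳ -ʳ four *ʳ (m · (α *ʳ α)))
      ≈⟨ R.*-cong R.≋-refl (R.+-cong R.≋-refl (R.-‿cong (R.*-cong R.≋-refl (·≋·1* m _)))) ⟩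
    M *ʳ (1ʳ -ʳ four *ʳ (M *ʳ (α *ʳ α)))
      ≈⟨ solve 2 (λ M α → M :* (con 1ℚ :- con (+ 4 / 1) :* (M :* (α :* α)))
           := M :- con (+ 4 / 1) :* ((M :* α) :* (M :* α))) R.≋-refl M α ⟩
    M -ʳ four *ʳ ((M *ʳ α) *ʳ (M *ʳ α))
      ≈⟨ R.+-cong R.≋-refl (R.-‿cong (R.*-cong (≋-pointwise {four} {4 · 1ʳ} λ _ → refl) (R.*-cong Mα≋D Mα≋D))) ⟩
    M -ʳ (4 · 1ʳ) *ʳ (D *ʳ D)
      ≈⟨ R.+-cong R.≋-refl (R.-‿cong (≋-trans (×1-homo-* 4 (d * d)) (R.*-cong R.≋-refl (×1-homo-* d d)))) ⟨
    M -ʳ (4 * (d * d)) · 1ʳ ∎))))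
  where
  open ≋-Reasoning
  open ℝ-Solver
  0≼1 : 0ʳ ≼ 1ʳ
  0≼1 = ≼-pointwise λ _ → ℚ.nonNegative⁻¹ 1ℚ
  four = fromℚ (+ 4 / 1)
  M = m · 1ʳ
  D = d · 1ʳ
  Mα≋D : M *ʳ α ≋ D
  Mα≋D = ≋-trans (≋-sym (·≋·1* m α)) mα≋d

-- Signed sums

sgn : Bool → ℝ
sgn true  = 1ʳ
sgn false = -ʳ 1ʳ

signedSum : ∀ {d} → (ℕ → Bool) → (ℕ → Matrix d) → ℕ → Matrix d
signedSum σ x zero    = 0ᴹ
signedSum σ x (suc n) = signedSum σ x n ⊕[ sgn (σ n) ] x n

-- Choosing the sign of a later vector does not disturb the sum over the earlier ones.
signedSum-cong : ∀ {d σ τ} {x : ℕ → Matrix d} n → (∀ j → j < n → σ j ≡ τ j) →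
  ∀ k l → signedSum σ x n k l ≡ signedSum τ x n k l
signedSum-cong zero eq k l = refl
signedSum-cong {x = x} (suc n) eq k l =
  cong₂ (λ z b → (re z +ʳ sgn b *ʳ re (x n k l)) +i (im z +ʳ sgn b *ʳ im (x n k l)))
    (signedSum-cong n (λ j j<n → eq j (ℕ.m<n⇒m<1+n j<n)) k l) (eq n ℕ.≤-refl)

energy : ∀ {d} → (ℕ → Bool) → (ℕ → Matrix d) → ℕ → ℝ
energy σ x n = ⟪ signedSum σ x n , signedSum σ x n ⟫

energy-cong : ∀ {d σ τ} {x : ℕ → Matrix d} n → (∀ j → j < n → σ j ≡ τ j) →
  energy σ x n ≋ energy τ x n
energy-cong {x = x} n eq = sumʳ-cong λ k → sumʳ-cong λ l →
  R.reflexive (cong (λ z → re z *ʳ re z +ʳ im z *ʳ im z) (signedSum-cong {x = x} n eq k l))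

-- This is why the matrix need not be stored: the right side only asks for signs and inner products
-- of two outer products.
⟪signedSum⟫ : ∀ {d} σ (x : ℕ → Matrix d) n A →
  ⟪ signedSum σ x n , A ⟫ ≋ Σ< n λ j → sgn (σ j) *ʳ ⟪ x j , A ⟫
⟪signedSum⟫ σ x zero    A = ⟪⟫-zeroˡ A
⟪signedSum⟫ σ x (suc n) A = ≋-trans (⟪⟫-linearˡ (signedSum σ x n) (sgn (σ n)) (x n) A)
  (R.+-cong (⟪signedSum⟫ σ x n A) R.≋-refl)

-- The square is expanded once for each vector of the pair. The signs are opposite, so the two
-- vectors meet in the term -2q, which may be dropped as q ≥ 0; the descent hypothesis disposes of
-- the terms linear in X.
energy-step : ∀ {d} σ (x : ℕ → Matrix d) n →
  σ (suc n) ≡ not (σ n) →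
  sgn (σ n) *ʳ (⟪ signedSum σ x n , x n ⟫ -ʳ ⟪ signedSum σ x n , x (suc n) ⟫) ≼ 0ʳ →
  0ʳ ≼ ⟪ x n , x (suc n) ⟫ →
  energy σ x (suc (suc n)) ≼ energy σ x n +ʳ (⟪ x n , x n ⟫ +ʳ ⟪ x (suc n) , x (suc n) ⟫)
energy-step σ x n opposite descent 0≤q = ≼-trans (≋⇒≼ expansion)
  (≼-trans (+-mono-≼ (≼-refl {E +ʳ (A +ʳ B)})
    (+-mono-≼ (+-mono-≼ descent descent) (-‿anti-≼ (+-mono-≼ 0≤q 0≤q))))
    (≋⇒≼ (solve 1 (λ e → e :+ ((con 0ℚ :+ con 0ℚ) :- (con 0ℚ :+ con 0ℚ)) := e) R.≋-refl _)))
  where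
  open ≋-Reasoning
  open ℝ-Solver
  X = signedSum σ x n
  s = sgn (σ n)
  t = sgn (σ (suc n))
  E = energy σ x n
  A = ⟪ x n , x n ⟫
  B = ⟪ x (suc n) , x (suc n) ⟫
  q = ⟪ x n , x (suc n) ⟫
  a = ⟪ X , x n ⟫
  b = ⟪ X , x (suc n) ⟫
  -- After a split on the sign the solver sees constants ±1 and finds s² = 1 and st = -1 by
  -- computation.
  identity : ∀ β E a b A B q →
    E +ʳ sgn β *ʳ (a +ʳ a) +ʳ sgn β *ʳ sgn β *ʳ A
      +ʳ sgn (not β) *ʳ ((b +ʳ sgn β *ʳ q) +ʳ (b +ʳ sgn β *ʳ q)) +ʳ sgn (not β) *ʳ sgn (not β) *ʳ B
    ≋ E +ʳ (A +ʳ B) +ʳ ((sgn β *ʳ (a -ʳ b) +ʳ sgn β *ʳ (a -ʳ b)) -ʳ (q +ʳ q))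
  identity true  = solve 6 (λ E a b A B q →
    E :+ con 1ℚ :* (a :+ a) :+ con 1ℚ :* con 1ℚ :* A
      :+ (:- con 1ℚ) :* ((b :+ con 1ℚ :* q) :+ (b :+ con 1ℚ :* q)) :+ (:- con 1ℚ) :* (:- con 1ℚ) :* B
    := E :+ (A :+ B) :+ ((con 1ℚ :* (a :- b) :+ con 1ℚ :* (a :- b)) :- (q :+ q))) R.≋-refl
  identity false = solve 6 (λ E a b A B q →
    E :+ (:- con 1ℚ) :* (a :+ a) :+ (:- con 1ℚ) :* (:- con 1ℚ) :* A
      :+ con 1ℚ :* ((b :+ (:- con 1ℚ) :* q) :+ (b :+ (:- con 1ℚ) :* q)) :+ con 1ℚ :* con 1ℚ :* B
    := E :+ (A :+ B) :+ (((:- con 1ℚ) :* (a :- b) :+ (:- con 1ℚ) :* (a :- b)) :- (q :+ q))) R.≋-refl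
  expansion : energy σ x (suc (suc n)) ≋ E +ʳ (A +ʳ B) +ʳ ((s *ʳ (a -ʳ b) +ʳ s *ʳ (a -ʳ b)) -ʳ (q +ʳ q))
  expansion = begin
    energy σ x (suc (suc n))
      ≈⟨ ⟪⟫-square (X ⊕[ s ] x n) t (x (suc n)) ⟩
    energy σ x (suc n) +ʳ t *ʳ (⟪ X ⊕[ s ] x n , x (suc n) ⟫ +ʳ ⟪ X ⊕[ s ] x n , x (suc n) ⟫) +ʳ t *ʳ t *ʳ B
      ≈⟨ R.+-cong (R.+-cong (⟪⟫-square X s (x n)) (R.*-cong R.≋-refl (R.+-cong cross cross))) R.≋-refl ⟩
    E +ʳ s *ʳ (a +ʳ a) +ʳ s *ʳ s *ʳ A +ʳ t *ʳ ((b +ʳ s *ʳ q) +ʳ (b +ʳ s *ʳ q)) +ʳ t *ʳ t *ʳ B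
      ≡⟨ cong (λ β → E +ʳ s *ʳ (a +ʳ a) +ʳ s *ʳ s *ʳ A
           +ʳ sgn β *ʳ ((b +ʳ s *ʳ q) +ʳ (b +ʳ s *ʳ q)) +ʳ sgn β *ʳ sgn β *ʳ B) opposite ⟩
    E +ʳ s *ʳ (a +ʳ a) +ʳ s *ʳ s *ʳ A
      +ʳ sgn (not (σ n)) *ʳ ((b +ʳ s *ʳ q) +ʳ (b +ʳ s *ʳ q)) +ʳ sgn (not (σ n)) *ʳ sgn (not (σ n)) *ʳ B
      ≈⟨ identity (σ n) E a b A B q ⟩
    E +ʳ (A +ʳ B) +ʳ ((s *ʳ (a -ʳ b) +ʳ s *ʳ (a -ʳ b)) -ʳ (q +ʳ q)) ∎
    where
    cross : ⟪ X ⊕[ s ] x n , x (suc n) ⟫ ≋ b +ʳ s *ʳ q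
    cross = ⟪⟫-linearˡ X s (x n) (x (suc n))

-- Expand 0 ≤ |Z − 2sX|².
4s⟪X,Z⟫≼2 : ∀ {d} (X Z : Matrix d) → fromℚ (+ 4 / 1) *ʳ ⟪ X , X ⟫ ≼ 1ʳ → ⟪ Z , Z ⟫ ≋ 1ʳ →
  ∀ β → fromℚ (+ 4 / 1) *ʳ (sgn β *ʳ ⟪ X , Z ⟫) ≼ fromℚ (+ 2 / 1)
4s⟪X,Z⟫≼2 X Z E≤¼ unit β = 0≼-⇒≼ (≼-trans (⟪⟫-nonneg (Z ⊕[ c ] X)) (≼-trans (≋⇒≼ (begin
    ⟪ Z ⊕[ c ] X , Z ⊕[ c ] X ⟫
      ≈⟨ ⟪⟫-square Z c X ⟩
    ⟪ Z , Z ⟫ +ʳ c *ʳ (⟪ Z , X ⟫ +ʳ ⟪ Z , X ⟫) +ʳ c *ʳ c *ʳ ⟪ X , X ⟫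
      ≈⟨ R.+-cong (R.+-cong unit (R.*-cong R.≋-refl (R.+-cong (⟪⟫-comm Z X) (⟪⟫-comm Z X)))) R.≋-refl ⟩
    1ʳ +ʳ c *ʳ (⟪ X , Z ⟫ +ʳ ⟪ X , Z ⟫) +ʳ c *ʳ c *ʳ ⟪ X , X ⟫
      ≈⟨ identity β ⟪ X , Z ⟫ ⟪ X , X ⟫ ⟩
    1ʳ -ʳ fromℚ (+ 4 / 1) *ʳ (sgn β *ʳ ⟪ X , Z ⟫) +ʳ fromℚ (+ 4 / 1) *ʳ ⟪ X , X ⟫ ∎))
    (≼-trans (+-mono-≼ ≼-refl E≤¼)
      (≋⇒≼ (solve 1 (λ y → con 1ℚ :- y :+ con 1ℚ := con (+ 2 / 1) :- y) R.≋-refl _)))))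
  where
  open ≋-Reasoning
  open ℝ-Solver
  c = fromℚ (ℚ.- (+ 2 / 1)) *ʳ sgn β
  identity : ∀ β y E → let c = fromℚ (ℚ.- (+ 2 / 1)) *ʳ sgn β in
    1ʳ +ʳ c *ʳ (y +ʳ y) +ʳ c *ʳ c *ʳ E ≋ 1ʳ -ʳ fromℚ (+ 4 / 1) *ʳ (sgn β *ʳ y) +ʳ fromℚ (+ 4 / 1) *ʳ E
  identity true  = solve 2 (λ y E → let c = con (ℚ.- (+ 2 / 1)) :* con 1ℚ in
    con 1ℚ :+ c :* (y :+ y) :+ c :* c :* E
      := con 1ℚ :- con (+ 4 / 1) :* (con 1ℚ :* y) :+ con (+ 4 / 1) :* E) R.≋-refl
  identity false = solve 2 (λ y E → let c = con (ℚ.- (+ 2 / 1)) :* (:- con 1ℚ) in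
    con 1ℚ :+ c :* (y :+ y) :+ c :* c :* E
      := con 1ℚ :- con (+ 4 / 1) :* ((:- con 1ℚ) :* y) :+ con (+ 4 / 1) :* E) R.≋-refl

-- Twice an indicator is 1 plus the sign, so twice the selected sum s is 1 + T. Then 8(¾ - s) = 6 -
-- 4(1 + T) = 2 - 4T.
sumOver-≼-¾ : ExcludedMiddle 0ℓ → ∀ {m} (S : Subset m) (f : Vector ℝ m) {T} →
  sumʳ f ≋ 1ʳ → sumʳ (λ i → sgn (lookup S i) *ʳ f i) ≋ T →
  fromℚ (+ 4 / 1) *ʳ T ≼ fromℚ (+ 2 / 1) → sumOver S f ≼ fromℚ (+ 3 / 4)
sumOver-≼-¾ em S f {T} Σf≋1 signed≋T 4T≤2 = 0≼-⇒≼ (·-cancel-nonneg em {8} (s≤s z≤n)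
  (≼-trans (≼⇒0≼- 4T≤2) (≋⇒≽ (begin
    8 · (fromℚ (+ 3 / 4) -ʳ s)
      ≈⟨ solve 1 (λ s → let w = con (+ 3 / 4) :- s in
           w :+ (w :+ (w :+ (w :+ (w :+ (w :+ (w :+ (w :+ con 0ℚ)))))))
           := con (+ 6 / 1) :- con (+ 4 / 1) :* (s :+ s)) R.≋-refl s ⟩
    fromℚ (+ 6 / 1) -ʳ fromℚ (+ 4 / 1) *ʳ (s +ʳ s)
      ≈⟨ R.+-cong R.≋-refl (R.-‿cong (R.*-cong R.≋-refl double)) ⟩
    fromℚ (+ 6 / 1) -ʳ fromℚ (+ 4 / 1) *ʳ (1ʳ +ʳ T)
      ≈⟨ solve 1 (λ T → con (+ 6 / 1) :- con (+ 4 / 1) :* (con 1ℚ :+ T) := con (+ 2 / 1) :- con (+ 4 / 1) :* T) R.≋-refl T ⟩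
    fromℚ (+ 2 / 1) -ʳ fromℚ (+ 4 / 1) *ʳ T ∎))))
  where
  open ≋-Reasoning
  open ℝ-Solver
  s = sumOver S f
  selected : Vector ℝ _
  selected i = if lookup S i then f i else 0ʳ
  term : ∀ b y → (if b then y else 0ʳ) +ʳ (if b then y else 0ʳ) ≋ y +ʳ sgn b *ʳ y
  term true  = solve 1 (λ y → y :+ y := y :+ con 1ℚ :* y) R.≋-refl
  term false = solve 1 (λ y → con 0ℚ :+ con 0ℚ := y :+ (:- con 1ℚ) :* y) R.≋-refl
  double : s +ʳ s ≋ 1ʳ +ʳ T
  double = ≋-trans (≋-sym (∑-distrib-+ selected selected))
    (≋-trans (sumʳ-cong λ i → term (lookup S i) (f i))
    (≋-trans (∑-distrib-+ f (λ i → sgn (lookup S i) *ʳ f i)) (R.+-cong Σf≋1 signed≋T)))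

-- Total correctness with a time bound

-- The cost c is only an upper bound, so both branches of a test can share it.
Halts : Program → State → ℕ → (State → Set) → Set
Halts P s c Q = Σ[ s′ ∈ State ] Σ[ t ∈ ℕ ] (Run P s s′ t × t ≤ c × Q s′)

halts-seq : ∀ {P P′ s c c′ Q R} →
  Halts P s c Q → (∀ s′ → Q s′ → Halts P′ s′ c′ R) → Halts (P ⨾ P′) s (c + c′) R
halts-seq (s₁ , t₁ , r₁ , t₁≤c , q) next with s₂ , t₂ , r₂ , t₂≤c′ , q′ ← next s₁ q
  = s₂ , t₁ + t₂ , r-seq r₁ r₂ , ℕ.+-mono-≤ t₁≤c t₂≤c′ , q′

halts-weaken : ∀ {P s c c′ Q} → c ≤ c′ → Halts P s c Q → Halts P s c′ Q
halts-weaken c≤c′ (s′ , t , r , t≤c , q) = s′ , t , r , ℕ.≤-trans t≤c c≤c′ , q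

halts-ite : ∀ {b P P′ s c Q} → Dec (Holds b s) →
  (Holds b s → Halts P s c Q) → (¬ Holds b s → Halts P′ s c Q) → Halts (ite b P P′) s (suc c) Q
halts-ite (yes h) then-branch _ with s′ , t , r , t≤c , q ← then-branch h
  = s′ , suc t , r-then h r , s≤s t≤c , q
halts-ite (no ¬h) _ else-branch with s′ , t , r , t≤c , q ← else-branch ¬h
  = s′ , suc t , r-else ¬h r , s≤s t≤c , q

-- The invariant is indexed by the number of completed rounds. The cost counts one test per round
-- and the last, failing one.
halts-while : ∀ {b P c} (Inv : ℕ → State → Set) n →
  (∀ i s → i < n → Inv i s → Holds b s × Halts P s c (Inv (suc i))) →
  (∀ s → Inv n s → ¬ Holds b s) →
  ∀ s → Inv 0 s → Halts (while b P) s (suc (n * suc c)) (Inv n)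
halts-while {b} {P} {c} Inv n step stop s inv = go 0 n refl s inv
  where
  go : ∀ i r → i + r ≡ n → ∀ s → Inv i s → Halts (while b P) s (suc (r * suc c)) (Inv n)
  go i zero i+0≡n s inv rewrite trans (sym (ℕ.+-identityʳ i)) i+0≡n
    = s , 1 , r-exit (stop s inv) , ℕ.≤-refl , inv
  go i (suc r) i+r≡n s inv
    with h , s₁ , t₁ , r₁ , t₁≤c , inv₁ ← step i s (subst (i <_) i+r≡n (ℕ.m<m+n i (s≤s z≤n))) inv
    with s₂ , t₂ , r₂ , t₂≤ , inv₂ ← go (suc i) r (trans (sym (ℕ.+-suc i r)) i+r≡n) s₁ inv₁
    = s₂ , suc (t₁ + t₂) , r-loop h r₁ r₂
    , s≤s (ℕ.≤-trans (ℕ.+-mono-≤ t₁≤c t₂≤) (ℕ.≤-reflexive (ℕ.+-suc c (r * suc c)))) , inv₂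

-- Head and tail are separate because `Program` has no empty program.
block : Instr → List Instr → Program
block a []       = instr a
block a (b ∷ bs) = instr a ⨾ block b bs

-- The registers after a straight-line piece are found by evaluation, so many parts of the
-- invariants are `refl` or carry over as they are.
execs : Instr → List Instr → State → State
execs a []       s = exec a s
execs a (b ∷ bs) s = execs b bs (exec a s)

run-block : ∀ a as s → Run (block a as) s (execs a as s) (suc (length as))
run-block a []       s = r-instr
run-block a (b ∷ bs) s = r-seq r-instr (run-block b bs (exec a s))

halts-block : ∀ a as s {Q : State → Set} → Q (execs a as s) →
  Halts (block a as) s (suc (length as)) Q
halts-block a as s q = execs a as s , suc (length as) , run-block a as s , ℕ.≤-refl , q

halts-block-seq : ∀ a as s {P c Q} → Halts P (execs a as s) c Q →
  Halts (block a as ⨾ P) s (suc (length as) + c) Q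
halts-block-seq a as s (s′ , t , r , t≤c , q) =
  s′ , suc (length as) + t , r-seq (run-block a as s) r , ℕ.+-monoʳ-≤ (suc (length as)) t≤c , q

-- Equality of registers and of natural memory as functions, not pointwise: matching on `refl` makes
-- the next start state literally `mkState (reg s) (nmem s) μ`.
HaltsReal : Program → State → ℕ → ((ℕ → ℝ) → Set) → Set
HaltsReal P s c Q = Halts P s c λ s′ → reg s′ ≡ reg s × nmem s′ ≡ nmem s × Q (rmem s′)

halts-real-seq : ∀ {P P′ s c c′ Q R} → HaltsReal P s c Q →
  (∀ μ → Q μ → Halts P′ (mkState (reg s) (nmem s) μ) c′ R) → Halts (P ⨾ P′) s (c + c′) R
halts-real-seq h next = halts-seq h λ { (mkState _ _ μ) (refl , refl , q) → next μ q }

-- The greedy program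

-- `%re`, `%im`, `%tmp`, `%acc` and `%zero` hold addresses of scratch reals, `%base` the address of
-- the vector being correlated. The only test on naturals is ≤, so strict comparisons use the
-- successors `%n+1`, `%j+1` and `%k+1`. `%0` stays 0 and turns `add` into a copy.
%d %m %1 %2d %re %im %tmp %acc %zero %n %n+1 %j %j+1 %x %y %base %k+1 %bit %0 %x+1 %y+1 : Reg
%d    = 0
%m    = 1
%1    = 2
%2d   = 3
%re   = 4
%im   = 5
%tmp  = 6
%acc  = 7
%zero = 8
%n    = 9
%n+1  = 10
%j    = 11
%j+1  = 12
%x    = 13
%y    = 14
%base = 15
%k+1  = 16
%bit  = 17
%0    = 18
%x+1  = 19
%y+1  = 20

addProduct subProduct : Reg → Reg → Reg → Program
addProduct z x y = block (mulR %tmp x y) (addR z z %tmp ∷ [])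
subProduct z x y = block (mulR %tmp x y) (subR z z %tmp ∷ [])

-- With a + ib at `%x` and c + ie at `%y`, conj(a + ib)(c + ie) = (ac + be) + i(ae - bc).
innerProductStep : Program
innerProductStep =
  block (add %x+1 %x %1) (add %y+1 %y %1 ∷ [])
  ⨾ addProduct %re %x %y
  ⨾ addProduct %re %x+1 %y+1
  ⨾ addProduct %im %x %y+1
  ⨾ subProduct %im %x+1 %y
  ⨾ block (add %x %x+1 %1) (add %y %y+1 %1 ∷ add %k+1 %k+1 %1 ∷ [])

innerProduct : Program
innerProduct = while (leq %k+1 %d) innerProductStep

correlationStep : Program
correlationStep =
  block (zeroR %re) (zeroR %im ∷ [])
  -- `%x` has run through the previous vector and already points at the next one; only `%y` has to
  -- be rewound.
  ⨾ block (add %y %base %0) (const %k+1 1 ∷ [])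
  ⨾ innerProduct
  ⨾ block (mulR %re %re %re) (mulR %im %im %im ∷ addR %re %re %im ∷ [])
  ⨾ block (load %bit %j) []
  ⨾ ite (leq %1 %bit) (instr (addR %acc %acc %re)) (instr (subR %acc %acc %re))
  ⨾ block (add %j %j %1) (add %j+1 %j+1 %1 ∷ [])

correlation : Program
correlation =
  block (const %j 0) (const %j+1 1 ∷ const %x 0 ∷ [])
  ⨾ while (leq %j+1 %n) correlationStep

-- Flipping the sign of the accumulator between the two passes leaves ⟪X, bb* − aa*⟫ in it.
pairStep : Program
pairStep =
  instr (zeroR %acc)
  ⨾ correlation
  ⨾ instr (subR %acc %zero %acc)
  ⨾ block (add %base %base %2d) []
  ⨾ correlation
  ⨾ block (add %base %base %2d) []
  -- A nonnegative accumulator means ⟪X, aa* - bb*⟫ ≤ 0, so the first vector takes the plus sign,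
  -- otherwise the second. The other cell of the pair keeps its initial 0, which stands for minus.
  ⨾ ite (leqR %zero %acc) (instr (store %n %1)) (instr (store %n+1 %1))
  ⨾ block (add %n %n+1 %1) (add %n+1 %n %1 ∷ [])

greedy : Program
greedy =
  block (const %1 1) (add %2d %d %d ∷ const %k+1 1 ∷ [])
  -- Naturals cannot be multiplied, so the input length 2dm is reached by repeated addition. The
  -- scratch cells lie just behind the input.
  ⨾ while (leq %k+1 %m) (block (add %re %re %2d) (add %k+1 %k+1 %1 ∷ []))
  ⨾ block (add %im %re %1) (add %tmp %im %1 ∷ add %acc %tmp %1 ∷ add %zero %acc %1 ∷ const %n+1 1 ∷ [])
  ⨾ while (leq %n+1 %m) pairStep

-- Memory updates

≡ᵇ-refl : ∀ n → (n ≡ᵇ n) ≡ true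
≡ᵇ-refl zero    = refl
≡ᵇ-refl (suc n) = ≡ᵇ-refl n

≢⇒≡ᵇ-false : ∀ m n → m ≢ n → (m ≡ᵇ n) ≡ false
≢⇒≡ᵇ-false zero    zero    0≢0 = contradiction refl 0≢0
≢⇒≡ᵇ-false zero    (suc n) _   = refl
≢⇒≡ᵇ-false (suc m) zero    _   = refl
≢⇒≡ᵇ-false (suc m) (suc n) m≢n = ≢⇒≡ᵇ-false m n λ m≡n → m≢n (cong suc m≡n)

+-cancelˡ-≡ᵇ : ∀ l m n → (l + m ≡ᵇ l + n) ≡ (m ≡ᵇ n)
+-cancelˡ-≡ᵇ zero    m n = refl
+-cancelˡ-≡ᵇ (suc l) m n = +-cancelˡ-≡ᵇ l m n

update-same : ∀ {A : Set} (f : ℕ → A) a x → (f [ a ≔ x ]) a ≡ x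
update-same f a x rewrite ≡ᵇ-refl a = refl

update-other : ∀ {A : Set} (f : ℕ → A) a x b → a ≢ b → (f [ a ≔ x ]) b ≡ f b
update-other f a x b a≢b rewrite ≢⇒≡ᵇ-false a b a≢b = refl

bit : Bool → ℕ
bit b = if b then 1 else 0

1≤bit : ∀ {b} → 1 ≤ bit b → b ≡ true
1≤bit {true} _ = refl

1≰bit : ∀ {b} → ¬ 1 ≤ bit b → b ≡ false
1≰bit {true}  1≰1 = contradiction ℕ.≤-refl 1≰1
1≰bit {false} _   = refl

Encodes : (ℕ → Bool) → State → Set
Encodes σ s = ∀ j → nmem s j ≡ bit (σ j)

update-encodes : ∀ {σ} {ν : ℕ → ℕ} {a b y} → (∀ j → ν j ≡ bit (σ j)) → a ≡ b → y ≡ 1 →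
  ∀ j → (ν [ a ≔ y ]) j ≡ bit ((σ [ b ≔ true ]) j)
update-encodes {b = b} enc refl refl j with b ≡ᵇ j
... | true  = refl
... | false = enc j

-- Running time

innerProductTime correlationStepTime : ℕ → ℕ
-- Thirteen instructions of `innerProductStep` and one test per round.
innerProductTime d = suc (d * 14)
correlationStepTime d = 2 + (2 + (innerProductTime d + (3 + (1 + (2 + 2)))))

correlationTime pairStepTime : ℕ → ℕ → ℕ
correlationTime d m = 3 + suc (m * suc (correlationStepTime d))
pairStepTime d m = 1 + (correlationTime d m + (1 + (1 + (correlationTime d m + (1 + (2 + 2))))))

greedyTime : ℕ → ℕ → ℕ → ℕ
greedyTime d m q = 3 + (suc (m * 3) + (5 + suc (q * suc (pairStepTime d m))))

-- Every monomial has degree at most three in quantities bounded by m + d, and m + d ≥ 1 puts the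
-- lower powers below the cube. The coefficients 10, 3, 17, 28 and 28 add up to 86.
greedyTime≤ : ∀ {d m q} → 1 ≤ d → q ≤ m → greedyTime d m q ≤ 86 * (m + d) ^ 3
greedyTime≤ {d} {m} {q} 1≤d q≤m = begin
  greedyTime d m q
    ≡⟨ solve 3 (λ d m q →
         let c = con 3 :+ (con 1 :+ m :* (con 1 :+ (con 2 :+ (con 2 :+ (con 1 :+ d :* con 14 :+ con 8)))))
             p = con 1 :+ (c :+ (con 1 :+ (con 1 :+ (c :+ con 5))))
         in con 3 :+ (con 1 :+ m :* con 3 :+ (con 5 :+ (con 1 :+ q :* (con 1 :+ p))))
         := con 10 :* con 1 :+ con 3 :* m :+ con 17 :* q :+ con 28 :* (q :* m) :+ con 28 :* (q :* (m :* d))) refl d m q ⟩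
  10 * 1 + 3 * m + 17 * q + 28 * (q * m) + 28 * (q * (m * d))
    ≤⟨ ℕ.+-mono-≤ (ℕ.+-mono-≤ (ℕ.+-mono-≤ (ℕ.+-mono-≤
         (ℕ.*-monoʳ-≤ 10 (ℕ.^-monoʳ-≤ N {0} {3} z≤n))
         (ℕ.*-monoʳ-≤ 3 (linear m≤N)))
         (ℕ.*-monoʳ-≤ 17 (linear q≤N)))
         (ℕ.*-monoʳ-≤ 28 (ℕ.≤-trans (ℕ.*-mono-≤ q≤N (ℕ.≤-trans m≤N (ℕ.≤-reflexive (sym (ℕ.^-identityʳ N))))) (ℕ.^-monoʳ-≤ N {2} {3} (s≤s (s≤s z≤n))))))
         (ℕ.*-monoʳ-≤ 28 (ℕ.*-mono-≤ q≤N (ℕ.*-mono-≤ m≤N (ℕ.≤-trans d≤N (ℕ.≤-reflexive (sym (ℕ.^-identityʳ N))))))) ⟩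
  10 * N ^ 3 + 3 * N ^ 3 + 17 * N ^ 3 + 28 * N ^ 3 + 28 * N ^ 3
    ≡⟨ solve 1 (λ x → con 10 :* x :+ con 3 :* x :+ con 17 :* x :+ con 28 :* x :+ con 28 :* x := con 86 :* x) refl (N ^ 3) ⟩
  86 * N ^ 3 ∎
  where
  open ℕ.≤-Reasoning
  open ℕ-Solver
  N = m + d
  m≤N : m ≤ N
  m≤N = ℕ.m≤m+n m d
  q≤N : q ≤ N
  q≤N = ℕ.≤-trans q≤m m≤N
  d≤N : d ≤ N
  d≤N = ℕ.m≤n+m d m
  instance
    N≢0 : NonZero N
    N≢0 = >-nonZero (ℕ.≤-trans 1≤d d≤N)
  linear : ∀ {x} → x ≤ N → x ≤ N ^ 3
  linear x≤N = ℕ.≤-trans x≤N (ℕ.≤-trans (ℕ.≤-reflexive (sym (ℕ.^-identityʳ N))) (ℕ.^-monoʳ-≤ N {1} {3} (s≤s z≤n)))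

-- The run of the program on an arbitrary real memory

module Machine (d m : ℕ) (μ₀ : ℕ → ℝ) where

  -- The cell of the real part of coordinate k of vector j; the imaginary part comes next.
  addr : ℕ → ℕ → ℕ
  addr j k = j * (d + d) + (k + k)

  L : ℕ
  L = m * (d + d)

  addr-suc : ∀ j k → suc (addr j k) + 1 ≡ addr j (suc k)
  addr-suc j k = solve 2 (λ a k → con 1 :+ (a :+ (k :+ k)) :+ con 1 := a :+ ((con 1 :+ k) :+ (con 1 :+ k)))
    refl (j * (d + d)) k
    where open ℕ-Solver

  addr-next : ∀ j → addr j d ≡ addr (suc j) 0
  addr-next j = solve 2 (λ a d → a :+ d := d :+ a :+ con 0) refl (j * (d + d)) (d + d)
    where open ℕ-Solver

  addr-row : ∀ j → addr j 0 + (d + d) ≡ addr (suc j) 0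
  addr-row j = trans (cong (_+ (d + d)) (ℕ.+-identityʳ (j * (d + d)))) (addr-next j)

  addr<L : ∀ {j k} → j < m → k < d → suc (addr j k) < L
  addr<L {j} {k} j<m k<d = begin-strict
    suc (addr j k)             <⟨ ℕ.n<1+n _ ⟩
    suc (suc (addr j k))       ≡⟨ ℕ.+-comm 1 _ ⟩
    suc (addr j k) + 1         ≡⟨ addr-suc j k ⟩
    addr j (suc k)             ≤⟨ ℕ.+-monoʳ-≤ (j * (d + d)) (ℕ.+-mono-≤ k<d k<d) ⟩
    addr j d                   ≡⟨ addr-next j ⟩
    suc j * (d + d) + 0        ≡⟨ ℕ.+-identityʳ _ ⟩
    suc j * (d + d)            ≤⟨ ℕ.*-monoˡ-≤ (d + d) j<m ⟩
    L                          ∎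
    where open ℕ.≤-Reasoning

  -- Scratch cells are named by their offset from L. A write at a numeral offset then evaluates, so
  -- the values of the other scratch cells carry over definitionally.
  Layout : (ℕ → ℝ) → (ℕ → ℝ) → Set
  Layout μ w = (∀ a → a < L → μ a ≡ μ₀ a) × (∀ k → μ (L + k) ≡ w k)

  write : ∀ {μ w x y} k → Layout μ w → x ≡ L + k → Layout (μ [ x ≔ y ]) (w [ k ≔ y ])
  write {μ} {w} {y = y} k (input , scratch) refl =
      (λ a a<L → trans (update-other μ (L + k) y a λ eq → ℕ.<⇒≱ a<L (subst (L ≤_) eq (ℕ.m≤m+n L k))) (input a a<L))
    , λ j → trans (cong (if_then y else μ (L + j)) (+-cancelˡ-≡ᵇ L k j)) (cong (if k ≡ᵇ j then y else_) (scratch j))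

  read : ∀ {μ w x} k → Layout μ w → x ≡ L + k → μ x ≡ w k
  read k (_ , scratch) refl = scratch k

  -- The input cells are intact; the cells after them hold p, q, a temporary, A and 0.
  Memory : ℝ → ℝ → ℝ → (ℕ → ℝ) → Set
  Memory p q A μ = Σ[ w ∈ (ℕ → ℝ) ] (Layout μ w × w 0 ≡ p × w 1 ≡ q × w 3 ≡ A × w 4 ≡ 0ʳ)

  read-input : ∀ {p q A μ x a} → Memory p q A μ → x ≡ a → a < L → μ x ≡ μ₀ a
  read-input (_ , (input , _) , _) refl a<L = input _ a<L

  X : ℕ → ℕ → ℂ
  X j k = μ₀ (addr j k) +i μ₀ (suc (addr j k))

  -- These repeat the operations of the machine in their order, because memory is tracked up to `≡`
  -- while the ring laws hold only up to `_≋_`. The same goes for `signedG` and `pairG`.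
  dotRe dotIm : ℕ → ℕ → ℕ → ℝ
  dotRe j i zero    = 0ʳ
  dotRe j i (suc k) = dotRe j i k +ʳ re (X j k) *ʳ re (X i k) +ʳ im (X j k) *ʳ im (X i k)
  dotIm j i zero    = 0ʳ
  dotIm j i (suc k) = dotIm j i k +ʳ re (X j k) *ʳ im (X i k) -ʳ im (X j k) *ʳ re (X i k)

  G : ℕ → ℕ → ℝ
  G j i = dotRe j i d *ʳ dotRe j i d +ʳ dotIm j i d *ʳ dotIm j i d

  signedG : (ℕ → Bool) → ℕ → ℝ → ℕ → ℝ
  signedG σ i A zero    = A
  signedG σ i A (suc j) = if σ j then signedG σ i A j +ʳ G j i else signedG σ i A j -ʳ G j i

  pairG : (ℕ → Bool) → ℕ → ℝ
  pairG σ n = signedG σ (suc n) (0ʳ -ʳ signedG σ n 0ʳ n) n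

  -- Iterated products rather than records: the unchanged parts of an invariant
  -- then carry over definitionally to the state after an instruction.
  Constants : State → Set
  Constants s = reg s %d ≡ d × reg s %m ≡ m × reg s %1 ≡ 1 × reg s %2d ≡ d + d
    × reg s %re ≡ L + 0 × reg s %im ≡ L + 1 × reg s %tmp ≡ L + 2 × reg s %acc ≡ L + 3
    × reg s %zero ≡ L + 4 × reg s %0 ≡ 0

  Frame : (ℕ → Bool) → ℕ → State → Set
  Frame σ n s = Constants s × reg s %n ≡ n × reg s %n+1 ≡ suc n × Encodes σ s

  module _ {p q A : ℝ} (s : State) (consts : Constants s) (mem : Memory p q A (rmem s)) where

    private
      c-re   = proj₁ (proj₂ (proj₂ (proj₂ (proj₂ consts))))
      c-im   = proj₁ (proj₂ (proj₂ (proj₂ (proj₂ (proj₂ consts)))))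
      c-tmp  = proj₁ (proj₂ (proj₂ (proj₂ (proj₂ (proj₂ (proj₂ consts))))))
      c-acc  = proj₁ (proj₂ (proj₂ (proj₂ (proj₂ (proj₂ (proj₂ (proj₂ consts)))))))
      c-zero = proj₁ (proj₂ (proj₂ (proj₂ (proj₂ (proj₂ (proj₂ (proj₂ (proj₂ consts))))))))
      w      = proj₁ mem
      lay    = proj₁ (proj₂ mem)
      w-re   = proj₁ (proj₂ (proj₂ mem))
      w-im   = proj₁ (proj₂ (proj₂ (proj₂ mem)))
      w-acc  = proj₁ (proj₂ (proj₂ (proj₂ (proj₂ mem))))
      w-zero = proj₂ (proj₂ (proj₂ (proj₂ (proj₂ mem))))

    addProduct-re : ∀ {a b} x y → rmem s (reg s x) ≡ a → rmem s (reg s y) ≡ b →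
      HaltsReal (addProduct %re x y) s 2 (Memory (p +ʳ a *ʳ b) q A)
    addProduct-re x y e-x e-y = halts-block _ _ s (refl , refl , _ , l₂
      , cong₂ _+ʳ_ (trans (read 0 l₁ c-re) w-re) (trans (read 2 l₁ c-tmp) (cong₂ _*ʳ_ e-x e-y)) , w-im , w-acc , w-zero)
      where
      l₁ = write 2 lay c-tmp
      l₂ = write 0 l₁ c-re

    addProduct-im : ∀ {a b} x y → rmem s (reg s x) ≡ a → rmem s (reg s y) ≡ b →
      HaltsReal (addProduct %im x y) s 2 (Memory p (q +ʳ a *ʳ b) A)
    addProduct-im x y e-x e-y = halts-block _ _ s (refl , refl , _ , l₂
      , w-re , cong₂ _+ʳ_ (trans (read 1 l₁ c-im) w-im) (trans (read 2 l₁ c-tmp) (cong₂ _*ʳ_ e-x e-y)) , w-acc , w-zero)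
      where
      l₁ = write 2 lay c-tmp
      l₂ = write 1 l₁ c-im

    subProduct-im : ∀ {a b} x y → rmem s (reg s x) ≡ a → rmem s (reg s y) ≡ b →
      HaltsReal (subProduct %im x y) s 2 (Memory p (q -ʳ a *ʳ b) A)
    subProduct-im x y e-x e-y = halts-block _ _ s (refl , refl , _ , l₂
      , w-re , cong₂ _-ʳ_ (trans (read 1 l₁ c-im) w-im) (trans (read 2 l₁ c-tmp) (cong₂ _*ʳ_ e-x e-y)) , w-acc , w-zero)
      where
      l₁ = write 2 lay c-tmp
      l₂ = write 1 l₁ c-im

    square-norm : HaltsReal (block (mulR %re %re %re) (mulR %im %im %im ∷ addR %re %re %im ∷ [])) s 3
      (Memory (p *ʳ p +ʳ q *ʳ q) (q *ʳ q) A)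
    square-norm = halts-block _ _ s (refl , refl , _ , l₃
      , cong₂ _+ʳ_ (trans (read 0 l₂ c-re) re²) (trans (read 1 l₂ c-im) im²) , im² , w-acc , w-zero)
      where
      l₁ = write 0 lay c-re
      l₂ = write 1 l₁ c-im
      l₃ = write 0 l₂ c-re
      re² = cong₂ _*ʳ_ (trans (read 0 lay c-re) w-re) (trans (read 0 lay c-re) w-re)
      im² = cong₂ _*ʳ_ (trans (read 1 l₁ c-im) w-im) (trans (read 1 l₁ c-im) w-im)

    reset-dot : HaltsReal (block (zeroR %re) (zeroR %im ∷ [])) s 2 (Memory 0ʳ 0ʳ A)
    reset-dot = halts-block _ _ s (refl , refl , _ , write 1 (write 0 lay c-re) c-im , refl , refl , w-acc , w-zero)

    reset-acc : HaltsReal (instr (zeroR %acc)) s 1 (Memory p q 0ʳ)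
    reset-acc = halts-block _ [] s (refl , refl , _ , write 3 lay c-acc , w-re , w-im , refl , w-zero)

    add-acc : HaltsReal (instr (addR %acc %acc %re)) s 1 (Memory p q (A +ʳ p))
    add-acc = halts-block _ [] s (refl , refl , _ , write 3 lay c-acc , w-re , w-im
      , cong₂ _+ʳ_ (trans (read 3 lay c-acc) w-acc) (trans (read 0 lay c-re) w-re) , w-zero)

    sub-acc : HaltsReal (instr (subR %acc %acc %re)) s 1 (Memory p q (A -ʳ p))
    sub-acc = halts-block _ [] s (refl , refl , _ , write 3 lay c-acc , w-re , w-im
      , cong₂ _-ʳ_ (trans (read 3 lay c-acc) w-acc) (trans (read 0 lay c-re) w-re) , w-zero)

    negate-acc : HaltsReal (instr (subR %acc %zero %acc)) s 1 (Memory p q (0ʳ -ʳ A))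
    negate-acc = halts-block _ [] s (refl , refl , _ , write 3 lay c-acc , w-re , w-im
      , cong₂ _-ʳ_ (trans (read 4 lay c-zero) w-zero) (trans (read 3 lay c-acc) w-acc) , w-zero)

    read-acc : rmem s (reg s %acc) ≡ A
    read-acc = trans (read 3 lay c-acc) w-acc

    read-zero : rmem s (reg s %zero) ≡ 0ʳ
    read-zero = trans (read 4 lay c-zero) w-zero

  module _ (σ : ℕ → Bool) (n i : ℕ) (n≤m : n ≤ m) (i<m : i < m) where

    InnerProductInv : ℕ → ℝ → ℕ → State → Set
    InnerProductInv j A k s = Frame σ n s × reg s %j ≡ j × reg s %j+1 ≡ suc j × reg s %base ≡ addr i 0
      × reg s %x ≡ addr j k × reg s %y ≡ addr i k × reg s %k+1 ≡ suc k
      × Memory (dotRe j i k) (dotIm j i k) A (rmem s)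

    innerProductStep-correct : ∀ j A → j < m → ∀ k s → k < d → InnerProductInv j A k s →
      Halts innerProductStep s 13 (InnerProductInv j A (suc k))
    innerProductStep-correct j A j<m k s k<d
      (frame@(consts@(_ , _ , c-1 , _) , _) , e-j , e-j+1 , e-base , e-x , e-y , e-k , mem) =
      halts-block-seq _ _ s (
      halts-real-seq (addProduct-re (at (rmem s)) consts mem %x %y
        (read-input mem e-x x<L) (read-input mem e-y y<L)) λ μ₁ mem₁ →
      halts-real-seq (addProduct-re (at μ₁) consts mem₁ %x+1 %y+1
        (read-input mem₁ e-x+1 x+1<L) (read-input mem₁ e-y+1 y+1<L)) λ μ₂ mem₂ →
      halts-real-seq (addProduct-im (at μ₂) consts mem₂ %x %y+1
        (read-input mem₂ e-x x<L) (read-input mem₂ e-y+1 y+1<L)) λ μ₃ mem₃ →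
      halts-real-seq (subProduct-im (at μ₃) consts mem₃ %x+1 %y
        (read-input mem₃ e-x+1 x+1<L) (read-input mem₃ e-y y<L)) λ μ₄ mem₄ →
      halts-block _ _ (at μ₄) (frame , e-j , e-j+1 , e-base
        , trans (cong₂ _+_ e-x+1 c-1) (addr-suc j k)
        , trans (cong₂ _+_ e-y+1 c-1) (addr-suc i k)
        , trans (cong₂ _+_ e-k c-1) (ℕ.+-comm (suc k) 1)
        , mem₄))
      where
      at : (ℕ → ℝ) → State
      at = mkState (reg (execs (add %x+1 %x %1) (add %y+1 %y %1 ∷ []) s)) (nmem s)
      x+1<L = addr<L j<m k<d
      y+1<L = addr<L i<m k<d
      x<L = ℕ.<-trans (ℕ.n<1+n _) x+1<L
      y<L = ℕ.<-trans (ℕ.n<1+n _) y+1<L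
      e-x+1 : reg s %x + reg s %1 ≡ suc (addr j k)
      e-x+1 = trans (cong₂ _+_ e-x c-1) (ℕ.+-comm (addr j k) 1)
      e-y+1 : reg s %y + reg s %1 ≡ suc (addr i k)
      e-y+1 = trans (cong₂ _+_ e-y c-1) (ℕ.+-comm (addr i k) 1)

    innerProduct-correct : ∀ j A → j < m → ∀ s → InnerProductInv j A 0 s →
      Halts innerProduct s (innerProductTime d) (InnerProductInv j A d)
    innerProduct-correct j A j<m = halts-while (InnerProductInv j A) d
      (λ { k s k<d inv@(((c-d , _) , _) , _ , _ , _ , _ , _ , e-k , _) →
        subst₂ _≤_ (sym e-k) (sym c-d) k<d , innerProductStep-correct j A j<m k s k<d inv })
      (λ { s (((c-d , _) , _) , _ , _ , _ , _ , _ , e-k , _) h →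
        ℕ.<-irrefl refl (subst₂ _≤_ e-k c-d h) })

    CorrelationInv : ℝ → ℕ → State → Set
    CorrelationInv A j s = Frame σ n s × reg s %j ≡ j × reg s %j+1 ≡ suc j × reg s %base ≡ addr i 0
      × reg s %x ≡ addr j 0 × Σ[ p ∈ ℝ ] Σ[ q ∈ ℝ ] Memory p q (signedG σ i A j) (rmem s)

    correlationStep-correct : ∀ A j s → j < n → CorrelationInv A j s →
      Halts correlationStep s (correlationStepTime d) (CorrelationInv A (suc j))
    correlationStep-correct A j s j<n
      (frame@(consts@(_ , _ , _ , _ , _ , _ , _ , _ , _ , c-0) , _) , e-j , e-j+1 , e-base , e-x , _ , _ , mem) =
      halts-real-seq (reset-dot s consts mem) λ μ₁ mem₁ →
      halts-block-seq _ _ (mkState (reg s) (nmem s) μ₁) (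
      halts-seq (innerProduct-correct j (signedG σ i A j) (ℕ.<-≤-trans j<n n≤m) _
        (frame , e-j , e-j+1 , e-base , e-x , trans (cong₂ _+_ e-base c-0) (ℕ.+-identityʳ _) , refl , mem₁))
      λ { s₂ (frame₂@(consts₂@(_ , _ , c-1 , _) , _ , _ , encodes) , e-j , e-j+1 , e-base , e-x , e-y , e-k , mem₂) →
      halts-real-seq (square-norm s₂ consts₂ mem₂) λ μ₃ mem₃ →
      halts-block-seq _ _ (mkState (reg s₂) (nmem s₂) μ₃) (
      let e-bit = trans (cong (nmem s₂) e-j) (encodes j)
          s₃    = exec (load %bit %j) (mkState (reg s₂) (nmem s₂) μ₃)
      in
      -- Each branch proves `updated` at a fixed truth value, which the tested bit identifies with
      -- `σ j`.
      halts-real-seq {Q = updated (σ j)} (halts-ite (_ ℕ.≤? _)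
        (λ h → subst (λ b → HaltsReal _ s₃ 1 (updated b))
          (sym (1≤bit (subst₂ _≤_ c-1 e-bit h))) (add-acc s₃ consts₂ mem₃))
        (λ ¬h → subst (λ b → HaltsReal _ s₃ 1 (updated b))
          (sym (1≰bit λ h → ¬h (subst₂ _≤_ (sym c-1) (sym e-bit) h))) (sub-acc s₃ consts₂ mem₃)))
      λ μ₄ mem₄ →
      halts-block _ _ (mkState (reg s₃) (nmem s₃) μ₄) (frame₂
        , trans (cong₂ _+_ e-j c-1) (ℕ.+-comm j 1)
        , trans (cong₂ _+_ e-j+1 c-1) (ℕ.+-comm (suc j) 1)
        , e-base , trans e-x (addr-next j) , _ , _ , mem₄)) })
      where
      updated : Bool → (ℕ → ℝ) → Set
      updated b = Memory (G j i) (dotIm j i d *ʳ dotIm j i d)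
        (if b then signedG σ i A j +ʳ G j i else signedG σ i A j -ʳ G j i)

    correlation-correct : ∀ {p q} A s → Frame σ n s → reg s %base ≡ addr i 0 → Memory p q A (rmem s) →
      Halts correlation s (correlationTime d m) λ s′ → Frame σ n s′ × reg s′ %base ≡ addr i 0
        × Σ[ p ∈ ℝ ] Σ[ q ∈ ℝ ] Memory p q (signedG σ i A n) (rmem s′)
    correlation-correct A s frame e-base mem =
      halts-weaken (ℕ.+-monoʳ-≤ 3 (s≤s (ℕ.*-monoˡ-≤ (suc (correlationStepTime d)) n≤m)))
      (halts-block-seq _ _ s (weaken-post
        (halts-while (CorrelationInv A) n
          (λ { j s j<n inv@((_ , e-n , _) , _ , e-j+1 , _) →
            subst₂ _≤_ (sym e-j+1) (sym e-n) j<n , correlationStep-correct A j s j<n inv })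
          (λ { s ((_ , e-n , _) , _ , e-j+1 , _) h → ℕ.<-irrefl refl (subst₂ _≤_ e-j+1 e-n h) })
          _ (frame , refl , refl , e-base , refl , _ , _ , mem))))
      where
      weaken-post : ∀ {P s c} → Halts P s c (CorrelationInv A n) → Halts P s c λ s′ → Frame σ n s′ × reg s′ %base ≡ addr i 0
        × Σ[ p ∈ ℝ ] Σ[ q ∈ ℝ ] Memory p q (signedG σ i A n) (rmem s′)
      weaken-post (s′ , t , r , t≤c , frame , _ , _ , e-base , _ , mem) = s′ , t , r , t≤c , frame , e-base , mem

  -- Leaving `Good` open separates the run from the analysis: here it matters only that either
  -- outcome of the comparison extends `Good` by one pair.
  module Greedy (em : ExcludedMiddle 0ℓ) (Good : ℕ → (ℕ → Bool) → Set) (q : ℕ) (m≡q*2 : m ≡ q * 2)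
    (good-zero : Good 0 (λ _ → false))
    (good-fst : ∀ k σ → k < q → Good k σ → 0ʳ ≼ pairG σ (k * 2) → Good (suc k) (σ [ k * 2 ≔ true ]))
    (good-snd : ∀ k σ → k < q → Good k σ → ¬ 0ʳ ≼ pairG σ (k * 2) → Good (suc k) (σ [ suc (k * 2) ≔ true ]))
    where

    PairInv : ℕ → State → Set
    PairInv k s = Σ[ σ ∈ (ℕ → Bool) ] (Good k σ × Frame σ (k * 2) s × reg s %base ≡ addr (k * 2) 0
      × Σ[ p ∈ ℝ ] Σ[ q ∈ ℝ ] Σ[ A ∈ ℝ ] Memory p q A (rmem s))

    pairStep-correct : ∀ k s → k < q → PairInv k s → Halts pairStep s (pairStepTime d m) (PairInv (suc k))
    pairStep-correct k s k<q (σ , good , frame@(consts , _) , e-base , _ , _ , _ , mem) =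
      halts-real-seq (reset-acc s consts mem) λ μ₁ mem₁ →
      halts-seq (correlation-correct σ n n n≤m n<m 0ʳ (mkState (reg s) (nmem s) μ₁) frame e-base mem₁)
      λ { s₂ (frame₂@(consts₂@(_ , _ , _ , c-2d , _) , _) , e-base₂ , _ , _ , mem₂) →
      halts-real-seq (negate-acc s₂ consts₂ mem₂) λ μ₃ mem₃ →
      halts-block-seq _ _ (mkState (reg s₂) (nmem s₂) μ₃) (
      halts-seq (correlation-correct σ n (suc n) n≤m 1+n<m _ _ frame₂
        (trans (cong₂ _+_ e-base₂ c-2d) (addr-row n)) mem₃)
      λ { s₄ ((consts₄@(_ , _ , c-1 , c-2d , _) , e-n , e-n+1 , encodes) , e-base₄ , _ , _ , mem₄) →
      halts-block-seq _ _ s₄ (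
      let e-base₅ = trans (cong₂ _+_ e-base₄ c-2d) (addr-row (suc n))
          s₅      = exec (add %base %base %2d) s₄
      in
      halts-seq {Q = λ s′ → reg s′ ≡ reg s₅ × rmem s′ ≡ rmem s₅ × Σ[ σ ∈ (ℕ → Bool) ] (Good (suc k) σ × Encodes σ s′)}
        -- The comparison of reals is decided classically, and only the existence of the run rests
        -- on that.
        (halts-ite em
          (λ h → halts-block _ [] s₅ (refl , refl , _
            , good-fst k σ k<q good (wrap (subst₂ _≤ʳ_ (read-zero s₄ consts₄ mem₄) (read-acc s₄ consts₄ mem₄) h))
            , update-encodes {σ} encodes e-n c-1))
          (λ ¬h → halts-block _ [] s₅ (refl , refl , _
            , good-snd k σ k<q good (λ h → ¬h (subst₂ _≤ʳ_ (sym (read-zero s₄ consts₄ mem₄)) (sym (read-acc s₄ consts₄ mem₄)) (≼⇒≤ʳ h)))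
            , update-encodes {σ} encodes e-n+1 c-1)))
      λ { s₆@(mkState _ _ _) (refl , refl , σ′ , good′ , encodes′) →
      halts-block _ _ s₆ (σ′ , good′
        , (consts₄ , e-n₆ e-n+1 c-1 , trans (cong₂ _+_ (e-n₆ e-n+1 c-1) c-1) (ℕ.+-comm (suc (suc n)) 1) , encodes′)
        , e-base₅ , _ , _ , _ , mem₄) }) }) }
      where
      n = k * 2
      1+n<m : suc n < m
      1+n<m = subst (suc (suc n) ≤_) (sym m≡q*2) (ℕ.*-monoˡ-≤ 2 k<q)
      n<m : n < m
      n<m = ℕ.<-trans (ℕ.n<1+n n) 1+n<m
      n≤m : n ≤ m
      n≤m = ℕ.<⇒≤ n<m
      e-n₆ : ∀ {x y} → x ≡ suc n → y ≡ 1 → x + y ≡ suc (suc n)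
      e-n₆ refl refl = ℕ.+-comm (suc n) 1

    ScratchInv : ℕ → State → Set
    ScratchInv k s = reg s %d ≡ d × reg s %m ≡ m × reg s %1 ≡ 1 × reg s %2d ≡ d + d × reg s %re ≡ k * (d + d)
      × reg s %k+1 ≡ suc k × reg s %n ≡ 0 × reg s %base ≡ 0 × reg s %0 ≡ 0
      × (∀ j → nmem s j ≡ 0) × (∀ a → rmem s a ≡ μ₀ a)

    -- The cell addressed by `%zero` is read but never written, so it has to hold 0 at the start;
    -- the other scratch cells may hold anything.
    greedy-correct : μ₀ (L + 4) ≡ 0ʳ →
      Halts greedy (mkState ((λ _ → 0) [ 0 ≔ d ] [ 1 ≔ m ]) (λ _ → 0) μ₀) (greedyTime d m q)
        λ s → Σ[ σ ∈ (ℕ → Bool) ] (Good q σ × Encodes σ s)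
    greedy-correct zero-cell =
      halts-block-seq _ _ _ (
      halts-seq (halts-while ScratchInv m
        (λ { k s k<m (c-d , c-m , c-1 , c-2d , e-re , e-k , rest) →
          subst₂ _≤_ (sym e-k) (sym c-m) k<m
          , halts-block _ _ s (c-d , c-m , c-1 , c-2d
              , trans (cong₂ _+_ e-re c-2d) (ℕ.+-comm (k * (d + d)) (d + d))
              , trans (cong₂ _+_ e-k c-1) (ℕ.+-comm (suc k) 1) , rest) })
        (λ { s (_ , c-m , _ , _ , _ , e-k , _) h → ℕ.<-irrefl refl (subst₂ _≤_ e-k c-m h) })
        _ (refl , refl , refl , refl , refl , refl , refl , refl , refl , (λ _ → refl) , (λ _ → refl)))
      λ { s (c-d , c-m , c-1 , c-2d , e-re , e-k , e-n , e-base , c-0 , ν≡0 , μ≡μ₀) →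
      let e-im   = cong₂ _+_ e-re c-1
          e-tmp  = trans (cong₂ _+_ e-im c-1) (ℕ.+-assoc L 1 1)
          e-acc  = trans (cong₂ _+_ e-tmp c-1) (ℕ.+-assoc L 2 1)
          e-zero = trans (cong₂ _+_ e-acc c-1) (ℕ.+-assoc L 3 1)
      in
      halts-block-seq _ _ s (weaken-post (halts-while PairInv q
        (λ { k s k<q inv@(_ , _ , ((_ , c-m , _) , _ , e-n+1 , _) , _) →
          subst₂ _≤_ (sym e-n+1) (sym (trans c-m m≡q*2)) (ℕ.<-trans (ℕ.n<1+n _) (ℕ.*-monoˡ-≤ 2 k<q))
          , pairStep-correct k s k<q inv })
        (λ { s (_ , _ , ((_ , c-m , _) , _ , e-n+1 , _) , _) h →
          ℕ.<-irrefl refl (subst₂ _≤_ e-n+1 (trans c-m m≡q*2) h) })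
        _ ((λ _ → false) , good-zero
          , ((c-d , c-m , c-1 , c-2d , trans e-re (sym (ℕ.+-identityʳ L)) , e-im , e-tmp , e-acc , e-zero , c-0)
            , e-n , refl , ν≡0)
          , e-base , _ , _ , _ , (λ k → μ₀ (L + k)) , ((λ a _ → μ≡μ₀ a) , (λ k → μ≡μ₀ (L + k)))
          , refl , refl , refl , zero-cell))) })
      where
      weaken-post : ∀ {P s c} → Halts P s c (PairInv q) → Halts P s c λ s → Σ[ σ ∈ (ℕ → Bool) ] (Good q σ × Encodes σ s)
      weaken-post (s′ , t , r , t≤c , σ , good , (_ , _ , _ , encodes) , _) = s′ , t , r , t≤c , σ , good , encodes

-- The input memory

padWithZeros-toℕ : ∀ {n} (f : Vector ℝ n) i → padWithZeros f (toℕ i) ≡ f i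
padWithZeros-toℕ f zero    = refl
padWithZeros-toℕ f (suc i) = padWithZeros-toℕ (tail f) i

padWithZeros-beyond : ∀ {n} (f : Vector ℝ n) k → padWithZeros f (n + k) ≡ 0ʳ
padWithZeros-beyond {zero}  f k = refl
padWithZeros-beyond {suc n} f k = padWithZeros-beyond (tail f) k

concat-combine : ∀ {A : Set} {m n} (f : Vector (Vector A n) m) i j → concat f (combine i j) ≡ f i j
concat-combine {n = n} f i j = cong (λ p → f (proj₂ p) (proj₁ p)) (cong swap (Fin.remQuot-combine {k = n} i j))

⟨⟩-congʳ : ∀ {d} (u : Vector ℂ d) {v w} → (∀ k → v k ≡ w k) → ⟨ u , v ⟩ ≡ ⟨ u , w ⟩
⟨⟩-congʳ {zero}  u eq = refl
⟨⟩-congʳ {suc d} u eq = cong₂ _+ᶜ_ (cong (conj (u zero) *ᶜ_) (eq zero)) (⟨⟩-congʳ (tail u) λ k → eq (suc k))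

parts : ℂ → Vector ℝ 2
parts z = re z Vector.∷ im z Vector.∷ Vector.[]

rows : ∀ {d m} → (Fin m → Vector ℂ d) → Vector (Vector ℝ (d * 2)) m
rows v i = concat (map parts (v i))

inputMemory : ∀ {d m} → (Fin m → Vector ℂ d) → ℕ → ℝ
inputMemory v = padWithZeros (concat (rows v))

-- Two nested uses of `combine`, for the vector and for the part of a coordinate, undo the two
-- `concat`s of the input.
inputMemory-cell : ∀ {d m} (v : Fin m → Vector ℂ d) i k b →
  inputMemory v (d * 2 * toℕ i + (2 * toℕ k + toℕ b)) ≡ parts (v i k) b
inputMemory-cell {d} v i k b = begin
  inputMemory v (d * 2 * toℕ i + (2 * toℕ k + toℕ b))
    ≡⟨ cong (λ y → inputMemory v (d * 2 * toℕ i + y)) (Fin.toℕ-combine k b) ⟨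
  inputMemory v (d * 2 * toℕ i + toℕ (combine k b))
    ≡⟨ cong (inputMemory v) (Fin.toℕ-combine i (combine k b)) ⟨
  inputMemory v (toℕ (combine i (combine k b)))
    ≡⟨ padWithZeros-toℕ (concat (rows v)) (combine i (combine k b)) ⟩
  concat (rows v) (combine i (combine k b))
    ≡⟨ concat-combine (rows v) i (combine k b) ⟩
  concat (map parts (v i)) (combine k b)
    ≡⟨ concat-combine (map parts (v i)) k b ⟩
  parts (v i k) b ∎
  where open ≡-Reasoning

inputMemory-re : ∀ {d m} (v : Fin m → Vector ℂ d) i k →
  inputMemory v (toℕ i * (d + d) + (toℕ k + toℕ k)) ≡ re (v i k)
inputMemory-re {d} v i k = trans (cong (inputMemory v)
    (solve 3 (λ i d k → i :* (d :+ d) :+ (k :+ k) := d :* con 2 :* i :+ (con 2 :* k :+ con 0)) refl (toℕ i) d (toℕ k)))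
  (inputMemory-cell v i k zero)
  where open ℕ-Solver

inputMemory-im : ∀ {d m} (v : Fin m → Vector ℂ d) i k →
  inputMemory v (suc (toℕ i * (d + d) + (toℕ k + toℕ k))) ≡ im (v i k)
inputMemory-im {d} v i k = trans (cong (inputMemory v)
    (solve 3 (λ i d k → con 1 :+ (i :* (d :+ d) :+ (k :+ k)) := d :* con 2 :* i :+ (con 2 :* k :+ con 1)) refl (toℕ i) d (toℕ k)))
  (inputMemory-cell v i k (suc zero))
  where open ℕ-Solver

inputMemory-beyond : ∀ {d m} (v : Fin m → Vector ℂ d) k → inputMemory v (m * (d + d) + k) ≡ 0ʳ
inputMemory-beyond {d} {m} v k = trans
  (cong (inputMemory v) (solve 3 (λ m d k → m :* (d :+ d) :+ k := m :* (d :* con 2) :+ k) refl m d k))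
  (padWithZeros-beyond (concat (rows v)) k)
  where open ℕ-Solver

-- Each pair adds one element to either side; the induction drops the first pair by shifting σ by
-- two.
∣S∣≡∣∁S∣ : ∀ q (σ : ℕ → Bool) → (∀ l → l < q → σ (suc (l * 2)) ≡ not (σ (l * 2))) →
  ∣ tabulate {n = q * 2} (λ i → σ (toℕ i)) ∣ ≡ ∣ ∁ (tabulate {n = q * 2} (λ i → σ (toℕ i))) ∣
∣S∣≡∣∁S∣ zero    σ opposite = refl
∣S∣≡∣∁S∣ (suc q) σ opposite
  with ih ← ∣S∣≡∣∁S∣ q (λ j → σ (suc (suc j))) (λ l l<q → opposite (suc l) (s≤s l<q))
  with σ 0 | σ 1 | opposite 0 (s≤s z≤n)
... | true  | false | refl = cong suc ih
... | false | true  | refl = cong suc ih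

-- Analysis of the greedy signs

module Correctness (em : ExcludedMiddle 0ℓ) (d q : ℕ) (v : Fin (q * 2) → Vector ℂ d) (α : ℝ)
  (frame : ∀ (u : Vector ℂ d) → IsUnit u → sumʳ (λ i → ∣ ⟨ u , v i ⟩ ∣²) ≋ 1ʳ)
  (norms : ∀ i → ‖ v i ‖² ≋ α) where

  m : ℕ
  m = q * 2

  open Machine d m (inputMemory v)

  -- The vectors as read back from memory, indexed by ℕ like the loops; `column-toℕ` identifies
  -- those below m with the given ones.
  column : ℕ → Vector ℂ d
  column j k = X j (toℕ k)

  column-toℕ : ∀ i k → column (toℕ i) k ≡ v i k
  column-toℕ i k = cong₂ _+i_ (inputMemory-re v i k) (inputMemory-im v i k)

  x : ℕ → Matrix d
  x j = outer (column j)

  ⟪x,outer⟫ : ∀ i u → ⟪ x (toℕ i) , outer u ⟫ ≋ ∣ ⟨ u , v i ⟩ ∣²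
  ⟪x,outer⟫ i u = ≋-trans (⟪⟫-comm (x (toℕ i)) (outer u)) (≋-trans (⟪outer,outer⟫ u (column (toℕ i)))
    (R.reflexive (cong ∣_∣² (⟨⟩-congʳ u (column-toℕ i)))))

  ⟪x,x⟫≋α² : ∀ {j} → j < m → ⟪ x j , x j ⟫ ≋ α *ʳ α
  ⟪x,x⟫≋α² {j} j<m = ≋-trans (⟪outer,outer⟫ (column j) (column j))
    (≋-trans (∣⟨v,v⟩∣²≋‖v‖²*‖v‖² (column j)) (R.*-cong norm norm))
    where
    norm : ‖ column j ‖² ≋ α
    norm = ≋-trans (sumʳ-cong λ k → R.reflexive (cong ∣_∣² (trans
        (cong (λ j → column j k) (sym (Fin.toℕ-fromℕ< j<m))) (column-toℕ (fromℕ< j<m) k))))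
      (norms (fromℕ< j<m))

  dotRe≋ : ∀ j i k → dotRe j i k ≋ Σ< k λ l → re (conj (X j l) *ᶜ X i l)
  dotRe≋ j i zero    = R.≋-refl
  dotRe≋ j i (suc k) = ≋-trans
    (solve 5 (λ s a b c e → s :+ a :* c :+ b :* e := s :+ (a :* c :- (:- b) :* e)) R.≋-refl
      (dotRe j i k) (re (X j k)) (im (X j k)) (re (X i k)) (im (X i k)))
    (R.+-cong (dotRe≋ j i k) R.≋-refl)
    where open ℝ-Solver

  dotIm≋ : ∀ j i k → dotIm j i k ≋ Σ< k λ l → im (conj (X j l) *ᶜ X i l)
  dotIm≋ j i zero    = R.≋-refl
  dotIm≋ j i (suc k) = ≋-trans
    (solve 5 (λ s a b c e → s :+ a :* e :- b :* c := s :+ (a :* e :+ (:- b) :* c)) R.≋-refl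
      (dotIm j i k) (re (X j k)) (im (X j k)) (re (X i k)) (im (X i k)))
    (R.+-cong (dotIm≋ j i k) R.≋-refl)
    where open ℝ-Solver

  G≋⟪x,x⟫ : ∀ j i → G j i ≋ ⟪ x j , x i ⟫
  G≋⟪x,x⟫ j i = ≋-trans (R.+-cong (R.*-cong re≋ re≋) (R.*-cong im≋ im≋))
    (≋-sym (⟪outer,outer⟫ (column j) (column i)))
    where
    term : Vector ℂ d
    term k = conj (column j k) *ᶜ column i k
    re≋ : dotRe j i d ≋ re ⟨ column j , column i ⟩
    re≋ = ≋-trans (dotRe≋ j i d) (≋-sym (≋-trans (R.reflexive (re-sumᶜ term)) (sum≋Σ< _ λ k → R.≋-refl)))
    im≋ : dotIm j i d ≋ im ⟨ column j , column i ⟩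
    im≋ = ≋-trans (dotIm≋ j i d) (≋-sym (≋-trans (R.reflexive (im-sumᶜ term)) (sum≋Σ< _ λ k → R.≋-refl)))

  signedG≋ : ∀ σ i A n → signedG σ i A n ≋ A +ʳ Σ< n λ j → sgn (σ j) *ʳ ⟪ x j , x i ⟫
  signedG≋ σ i A zero    = ≋-sym (R.+-identityʳ A)
  signedG≋ σ i A (suc n) = ≋-trans (step (σ n) (signedG σ i A n) (G n i)) (≋-trans
    (R.+-cong (signedG≋ σ i A n) (R.*-cong R.≋-refl (G≋⟪x,x⟫ n i)))
    (solve 3 (λ a b c → a :+ b :+ c := a :+ (b :+ c)) R.≋-refl _ _ _))
    where
    open ℝ-Solver
    step : ∀ b y g → (if b then y +ʳ g else y -ʳ g) ≋ y +ʳ sgn b *ʳ g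
    step true  = solve 2 (λ y g → y :+ g := y :+ con 1ℚ :* g) R.≋-refl
    step false = solve 2 (λ y g → y :- g := y :+ (:- con 1ℚ) :* g) R.≋-refl

  -- Ties the number that the machine compares with 0 to the descent term of `energy-step`, with the
  -- opposite orientation.
  pairG≋ : ∀ σ n → pairG σ n ≋ ⟪ signedSum σ x n , x (suc n) ⟫ -ʳ ⟪ signedSum σ x n , x n ⟫
  pairG≋ σ n = ≋-trans (signedG≋ σ (suc n) _ n) (≋-trans
    (R.+-cong (R.+-cong R.≋-refl (R.-‿cong (≋-trans (signedG≋ σ n 0ʳ n) (R.+-cong R.≋-refl (≋-sym (⟪signedSum⟫ σ x n (x n)))))))
      (≋-sym (⟪signedSum⟫ σ x n (x (suc n)))))
    (solve 2 (λ a b → con 0ℚ :- (con 0ℚ :+ a) :+ b := b :- a) R.≋-refl _ _))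
    where open ℝ-Solver

  -- The first clause is what lets a single write give a pair opposite signs; the last allows α² of
  -- energy per vector.
  Good : ℕ → (ℕ → Bool) → Set
  Good k σ = (∀ j → k * 2 ≤ j → σ j ≡ false)
           × (∀ l → l < k → σ (suc (l * 2)) ≡ not (σ (l * 2)))
           × energy σ x (k * 2) ≼ (k * 2) · (α *ʳ α)

  good-zero : Good 0 (λ _ → false)
  good-zero = (λ _ _ → refl) , (λ _ ()) , ≋⇒≼ (⟪⟫-zeroˡ {d} 0ᴹ)

  -- Serves both outcomes of the comparison: τ is known only through its values, not through which
  -- bit was set.
  good-step : ∀ k σ τ → k < q → Good k σ →
    (∀ j → j < k * 2 → τ j ≡ σ j) →
    (∀ j → suc (suc (k * 2)) ≤ j → τ j ≡ false) →
    τ (suc (k * 2)) ≡ not (τ (k * 2)) →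
    sgn (τ (k * 2)) *ʳ (⟪ signedSum σ x (k * 2) , x (k * 2) ⟫ -ʳ ⟪ signedSum σ x (k * 2) , x (suc (k * 2)) ⟫) ≼ 0ʳ →
    Good (suc k) τ
  good-step k σ τ k<q (_ , opposite , bound) agree fresh opposite-k descent =
    fresh , opposite′ , (begin
      energy τ x (suc (suc n))
        ≲⟨ energy-step τ x n opposite-k (≼-trans (≋⇒≼ (R.*-cong R.≋-refl
             (R.+-cong (⟪S⟫-agree (x n)) (R.-‿cong (⟪S⟫-agree (x (suc n))))))) descent) 0≼⟪x,x⟫ ⟩
      energy τ x n +ʳ (⟪ x n , x n ⟫ +ʳ ⟪ x (suc n) , x (suc n) ⟫)
        ≈⟨ R.+-cong (energy-cong {x = x} n agree) (R.+-cong (⟪x,x⟫≋α² n<m) (⟪x,x⟫≋α² 1+n<m)) ⟩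
      energy σ x n +ʳ (β +ʳ β)
        ≲⟨ +-mono-≼ bound ≼-refl ⟩
      n · β +ʳ (β +ʳ β)
        ≈⟨ solve 2 (λ a b → a :+ (b :+ b) := b :+ (b :+ a)) R.≋-refl (n · β) β ⟩
      suc (suc n) · β ∎)
    where
    open ≼-Reasoning
    open ℝ-Solver
    n = k * 2
    β = α *ʳ α
    1+n<m : suc n < m
    1+n<m = ℕ.*-monoˡ-≤ 2 k<q
    n<m : n < m
    n<m = ℕ.<-trans (ℕ.n<1+n n) 1+n<m
    0≼⟪x,x⟫ : 0ʳ ≼ ⟪ x n , x (suc n) ⟫
    0≼⟪x,x⟫ = ≼-trans (≼-trans (≋⇒≽ (R.+-identityˡ 0ʳ))
        (+-mono-≼ (0≼x*x (re ⟨ column n , column (suc n) ⟩)) (0≼x*x (im ⟨ column n , column (suc n) ⟩))))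
      (≋⇒≽ (⟪outer,outer⟫ (column n) (column (suc n))))
    ⟪S⟫-agree : ∀ B → ⟪ signedSum τ x n , B ⟫ ≋ ⟪ signedSum σ x n , B ⟫
    ⟪S⟫-agree B = ≋-trans (⟪signedSum⟫ τ x n B) (≋-trans
      (Σ<-cong n λ j j<n → R.reflexive (cong (λ b → sgn b *ʳ ⟪ x j , B ⟫) (agree j j<n)))
      (≋-sym (⟪signedSum⟫ σ x n B)))
    opposite′ : ∀ l → l < suc k → τ (suc (l * 2)) ≡ not (τ (l * 2))
    opposite′ l l<1+k with ℕ.m≤n⇒m<n∨m≡n (s≤s⁻¹ l<1+k)
    ... | inj₂ refl = opposite-k
    ... | inj₁ l<k  = trans (agree (suc (l * 2)) 1+2l<n) (trans (opposite l l<k)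
      (cong not (sym (agree (l * 2) (ℕ.<-trans (ℕ.n<1+n _) 1+2l<n)))))
      where
      1+2l<n : suc (l * 2) < n
      1+2l<n = ℕ.*-monoˡ-≤ 2 l<k

  good-fst : ∀ k σ → k < q → Good k σ → 0ʳ ≼ pairG σ (k * 2) → Good (suc k) (σ [ k * 2 ≔ true ])
  good-fst k σ k<q good@(fresh , _) 0≼pairG = good-step k σ (σ [ n ≔ true ]) k<q good
    (λ j j<n → update-other σ n true j (λ n≡j → ℕ.<⇒≢ j<n (sym n≡j)))
    (λ j 2+n≤j → trans (update-other σ n true j (ℕ.<⇒≢ (ℕ.≤-trans (ℕ.n≤1+n _) 2+n≤j)))
      (fresh j (ℕ.≤-trans (ℕ.m≤n+m n 2) 2+n≤j)))
    (trans (update-other σ n true (suc n) (ℕ.<⇒≢ (ℕ.n<1+n n)))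
      (trans (fresh (suc n) (ℕ.n≤1+n n)) (cong not (sym (update-same σ n true)))))
    (≼-trans (≋⇒≼ (≋-trans (R.*-cong (R.reflexive (cong sgn (update-same σ n true))) R.≋-refl)
        (≋-trans (solve 2 (λ a b → con 1ℚ :* (a :- b) := :- (b :- a)) R.≋-refl _ _) (R.-‿cong (≋-sym (pairG≋ σ n))))))
      (≼-trans (-‿anti-≼ 0≼pairG) (≋⇒≼ (solve 0 (:- con 0ℚ := con 0ℚ) R.≋-refl))))
    where
    open ℝ-Solver
    n = k * 2

  good-snd : ∀ k σ → k < q → Good k σ → ¬ 0ʳ ≼ pairG σ (k * 2) → Good (suc k) (σ [ suc (k * 2) ≔ true ])
  good-snd k σ k<q good@(fresh , _) 0⋠pairG = good-step k σ (σ [ suc n ≔ true ]) k<q good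
    (λ j j<n → update-other σ (suc n) true j (λ 1+n≡j → ℕ.<⇒≢ (ℕ.<-trans j<n (ℕ.n<1+n n)) (sym 1+n≡j)))
    (λ j 2+n≤j → trans (update-other σ (suc n) true j (ℕ.<⇒≢ 2+n≤j))
      (fresh j (ℕ.≤-trans (ℕ.m≤n+m n 2) 2+n≤j)))
    (trans (update-same σ (suc n) true) (cong not (sym unchanged)))
    (≼-trans (≋⇒≼ (≋-trans (R.*-cong (R.reflexive (cong sgn unchanged)) R.≋-refl)
        (≋-trans (solve 2 (λ a b → (:- con 1ℚ) :* (a :- b) := b :- a) R.≋-refl _ _) (≋-sym (pairG≋ σ n)))))
      pairG≼0)
    where
    open ℝ-Solver
    n = k * 2
    unchanged : (σ [ suc n ≔ true ]) n ≡ false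
    unchanged = trans (update-other σ (suc n) true n (λ 1+n≡n → ℕ.1+n≢n 1+n≡n)) (fresh n ℕ.≤-refl)
    pairG≼0 : pairG σ n ≼ 0ʳ
    pairG≼0 with ≼-total em 0ʳ (pairG σ n)
    ... | inj₁ 0≼ = contradiction 0≼ 0⋠pairG
    ... | inj₂ ≼0 = ≼0

  -- Passing to the complement reverses all signs, and the bound on the quadratic form holds for
  -- either sign β, so one argument covers both halves.
  half-bound : ∀ σ → Good q σ → 1 ≤ m → 4 * (d * d) ≤ m → ∀ β (S : Subset m) →
    (∀ i → sgn (lookup S i) ≋ sgn β *ʳ sgn (σ (toℕ i))) →
    ∀ u → IsUnit u → sumOver S (λ i → ∣ ⟨ u , v i ⟩ ∣²) ≤ʳ fromℚ (+ 3 / 4)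
  half-bound σ (_ , _ , bound) 1≤m 4d²≤m β S signs u unit =
    ≼⇒≤ʳ (sumOver-≼-¾ em S f (frame u unit) signed (4s⟪X,Z⟫≼2 Y U small unitᴹ β))
    where
    open ≋-Reasoning
    open ℝ-Solver
    f : Vector ℝ m
    f i = ∣ ⟨ u , v i ⟩ ∣²
    Y = signedSum σ x m
    U = outer u
    unitᴹ : ⟪ U , U ⟫ ≋ 1ʳ
    unitᴹ = ≋-trans (⟪outer,outer⟫ u u) (≋-trans (∣⟨v,v⟩∣²≋‖v‖²*‖v‖² u)
      (≋-trans (R.*-cong (wrap {y = 1ʳ} unit) (wrap {y = 1ʳ} unit)) (R.*-identityˡ 1ʳ)))
    small : fromℚ (+ 4 / 1) *ʳ ⟪ Y , Y ⟫ ≼ 1ʳ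
    small = ≼-trans (four-mono bound) (4mα²≼1 em {d} 1≤m 4d²≤m (m·α≋d v frame norms))
      where
      four-mono : ∀ {y z} → y ≼ z → fromℚ (+ 4 / 1) *ʳ y ≼ fromℚ (+ 4 / 1) *ʳ z
      four-mono {y} {z} y≼z = ≼-trans (≋⇒≼ (quadruple y))
        (≼-trans (+-mono-≼ (+-mono-≼ y≼z y≼z) (+-mono-≼ y≼z y≼z)) (≋⇒≽ (quadruple z)))
        where
        quadruple : ∀ y → fromℚ (+ 4 / 1) *ʳ y ≋ (y +ʳ y) +ʳ (y +ʳ y)
        quadruple = solve 1 (λ y → con (+ 4 / 1) :* y := (y :+ y) :+ (y :+ y)) R.≋-refl
    signed : sumʳ (λ i → sgn (lookup S i) *ʳ f i) ≋ sgn β *ʳ ⟪ Y , U ⟫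
    signed = begin
      sumʳ (λ i → sgn (lookup S i) *ʳ f i)
        ≈⟨ sumʳ-cong (λ i → ≋-trans (R.*-cong (signs i) R.≋-refl)
             (solve 3 (λ a b c → a :* b :* c := a :* (b :* c)) R.≋-refl (sgn β) (sgn (σ (toℕ i))) (f i))) ⟩
      sumʳ (λ i → sgn β *ʳ (sgn (σ (toℕ i)) *ʳ f i))
        ≈⟨ *-distribˡ-sum (sgn β) (λ i → sgn (σ (toℕ i)) *ʳ f i) ⟨
      sgn β *ʳ sumʳ (λ i → sgn (σ (toℕ i)) *ʳ f i)
        ≈⟨ R.*-cong R.≋-refl (sum≋Σ< (λ j → sgn (σ j) *ʳ ⟪ x j , U ⟫)
             λ i → R.*-cong R.≋-refl (≋-sym (⟪x,outer⟫ i u))) ⟩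
      sgn β *ʳ Σ< m (λ j → sgn (σ j) *ʳ ⟪ x j , U ⟫)
        ≈⟨ R.*-cong R.≋-refl (⟪signedSum⟫ σ x m U) ⟨
      sgn β *ʳ ⟪ Y , U ⟫ ∎

  open Greedy em Good q refl good-zero good-fst good-snd public using (greedy-correct)

theorem1p1 : ExcludedMiddle 0ℓ →
    Σ[ P ∈ Program ] Σ[ C ∈ ℕ ] Σ[ e ∈ ℕ ]
    (∀ (d m : ℕ) (v : Fin m → Vector ℂ d) (α : ℝ) →
    1 ≤ d →
    2 ∣ m →
    (∀ (u : Vector ℂ d) → IsUnit u → sumʳ (λ i → ∣ ⟨ u , v i ⟩ ∣²) ≈ʳ 1ʳ) →
    0ʳ <ʳ α →
    (∀ (i : Fin m) → ‖ v i ‖² ≈ʳ α) →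
    221 * d ^ 2 ≤ m →
    Σ[ s ∈ State ] Σ[ t ∈ ℕ ]
    (Run P (inputState v) s t
    × t ≤ C * (m + d) ^ e
    × Σ[ S₁ ∈ Subset m ] Σ[ S₂ ∈ Subset m ]
    (Outputs s S₁
    × S₁ ∪ S₂ ≡ full
    × S₁ ∩ S₂ ≡ empty
    × ∣ S₁ ∣ ≡ ∣ S₂ ∣
    × (∀ (u : Vector ℂ d) → IsUnit u → sumOver S₁ (λ i → ∣ ⟨ u , v i ⟩ ∣²) ≤ʳ fromℚ (+ 3 / 4))
    × (∀ (u : Vector ℂ d) → IsUnit u → sumOver S₂ (λ i → ∣ ⟨ u , v i ⟩ ∣²) ≤ʳ fromℚ (+ 3 / 4)))))
theorem1p1 em = greedy , 86 , 3 , λ { d .(q * 2) v α 1≤d (divides q refl) frame 0<α norms 221d²≤m →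
  let module C = Correctness em d q v α (λ u unit → wrap (frame u unit)) (λ i → wrap (norms i))
      s , t , run , t≤ , σ , good , encodes = C.greedy-correct (inputMemory-beyond v 4)
      S₁ = tabulate (λ i → σ (toℕ i))
      -- The 4 comes from requiring mα² = d²/m ≤ ¼. The power `d ^ 2` unfolds to `d * (d * 1)`,
      -- hence `*-identityʳ`.
      4d²≤m = ℕ.≤-trans (ℕ.*-mono-≤ {4} {221} (ℕ.m≤m+n 4 217)
        (ℕ.≤-reflexive (cong (d *_) (sym (ℕ.*-identityʳ d))))) 221d²≤m
      1≤m = ℕ.≤-trans (ℕ.*-mono-≤ {1} {4} (s≤s z≤n) (ℕ.*-mono-≤ 1≤d 1≤d)) 4d²≤m
      lookup-S₁ = lookup∘tabulate (λ i → σ (toℕ i))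
  in s , t , run
   , ℕ.≤-trans t≤ (greedyTime≤ 1≤d (ℕ.m≤m*n q 2))
   , S₁ , ∁ S₁
   , (λ i → trans (encodes (toℕ i)) (cong bit (sym (lookup-S₁ i))))
   , p∪∁p≡⊤ S₁ , ∩-inverseʳ S₁ , ∣S∣≡∣∁S∣ q σ (proj₁ (proj₂ good))
   , C.half-bound σ good 1≤m 4d²≤m true S₁
       (λ i → ≋-trans (R.reflexive (cong sgn (lookup-S₁ i))) (≋-sym (R.*-identityˡ _)))
   , C.half-bound σ good 1≤m 4d²≤m false (∁ S₁)
       (λ i → ≋-trans (R.reflexive (cong sgn (trans (lookup-map i not S₁) (cong not (lookup-S₁ i))))) (sgn-not (σ (toℕ i)))) }
  where
  sgn-not : ∀ b → sgn (not b) ≋ sgn false *ʳ sgn b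
  sgn-not true  = ≋-pointwise λ _ → refl
  sgn-not false = ≋-pointwise λ _ → refl
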